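{- (Typability preservation for $\pi$LL.) Let $P$ be a well-typed process. Then, for every label $l$ and process $P'$, $P\xrightarrow{l}P'$ implies that $P'$ is well-typed.
   Context: **Syntax.** Names $x,y,z,\ldots$ are drawn from an infinite set with decidable equality; $X$ ranges over type variables. Types: $A,B::=A\otimes B\mid A\wp B\mid 1\mid\bot\mid A\oplus B\mid A\&B\mid X\mid X^\perp\mid\exists X.A\mid\forall X.A\mid{?}A\mid{!}A$ ($\wp$ is the "par" connective). Processes: $P,Q::=x[y].P\mid x(y).P\mid x[].P\mid x().P\mid x[\mathsf{inl}].P\mid x[\mathsf{inr}].P\mid x\triangleright(P,Q)\mid x[A].P\mid x(X).P\mid{!}x(y).P\mid{?}x[y].P\mid{?}x[x_1,x_2].P\mid{?}x[].P\mid(\nu xy)P\mid P\parallel Q\mid\mathbf 0\mid x\leftrightarrow y$. Names written inside $[\cdot]$ or $(\cdot)$ of a prefix are bound in its continuation, $x,y$ are bound in $(\nu xy)P$, $X$ is bound in $x(X).P$; free names $\mathrm{fn}(P)$ and $=_\alpha$ are as usual, and $(\nu xy)P$ is identified with $(\nu yx)P$. **Typing.** Duality is the involution with $(A\otimes B)^\perp=A^\perp\wp B^\perp$, $1^\perp=\bot$, $(A\oplus B)^\perp=A^\perp\&B^\perp$, $({?}A)^\perp={!}A^\perp$, $(\exists X.A)^\perp=\forall X.A^\perp$, $(X)^\perp=X^\perp$, and symmetrically. An environment $\Gamma,\Delta,\ldots$ is a finite unordered list $x_1:A_1,\ldots,x_k:A_k$ of distinct names with types; "," joins environments with disjoint names.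 A hyperenvironment $\mathcal G=\Gamma_1\parallel\cdots\parallel\Gamma_n$ is a finite multiset of environments, all names distinct; $\emptyset$ is the hyperenvironment with no environments ("," binds tighter than $\parallel$). ${?}\Gamma$ denotes an environment all of whose types have the form ${?}A$. Typing rules (premises $\Rightarrow$ conclusion): (Ax) $\vdash x\leftrightarrow y::x:A^\perp,y:A$. (Cut) $\vdash P::\mathcal G\parallel\Gamma,x:A\parallel\Delta,y:A^\perp\Rightarrow\ \vdash(\nu xy)P::\mathcal G\parallel\Gamma,\Delta$. (Mix) $\vdash P::\mathcal G$ and $\vdash Q::\mathcal H\Rightarrow\ \vdash P\parallel Q::\mathcal G\parallel\mathcal H$. (Mix$_0$) $\vdash\mathbf 0::\emptyset$. ($\otimes$) $\vdash P::\Gamma,y:A\parallel\Delta,x:B\Rightarrow\ \vdash x[y].P::\Gamma,\Delta,x:A\otimes B$. (1) $\vdash P::\emptyset\Rightarrow\ \vdash x[].P::x:1$. ($\wp$) $\vdash P::\Gamma,y:A,x:B\Rightarrow\ \vdash x(y).P::\Gamma,x:A\wp B$. ($\bot$) $\vdash P::\Gamma\Rightarrow\ \vdash x().P::\Gamma,x:\bot$. ($\oplus_1$) $\vdash P::\Gamma,x:A\Rightarrow\ \vdash x[\mathsf{inl}].P::\Gamma,x:A\oplus B$. ($\oplus_2$) $\vdash P::\Gamma,x:B\Rightarrow\ \vdash x[\mathsf{inr}].P::\Gamma,x:A\oplus B$. ($\&$) $\vdash P::\Gamma,x:A$ and $\vdash Q::\Gamma,x:B\Rightarrow\ \vdash x\triangleright(P,Q)::\Gamma,x:A\&B$.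 (!) $\vdash P::{?}\Gamma,y:A\Rightarrow\ \vdash{!}x(y).P::{?}\Gamma,x:{!}A$. (?) $\vdash P::\Gamma,y:A\Rightarrow\ \vdash{?}x[y].P::\Gamma,x:{?}A$. (W) $\vdash P::\Gamma\Rightarrow\ \vdash{?}x[].P::\Gamma,x:{?}A$. (C) $\vdash P::\Gamma,x_1:{?}A,x_2:{?}A\Rightarrow\ \vdash{?}x[x_1,x_2].P::\Gamma,x:{?}A$. ($\exists$) $\vdash P::\Gamma,x:B\{A/X\}\Rightarrow\ \vdash x[A].P::\Gamma,x:\exists X.B$. ($\forall$) $\vdash P::\Gamma,x:B$, $X$ not free in $\Gamma$ $\Rightarrow\ \vdash x(X).P::\Gamma,x:\forall X.B$. $P$ is well-typed if $\vdash P::\mathcal G$ is derivable for some $\mathcal G$. **Labels.** Action labels (Act): $x[]$, $x()$, $x[y]$, $x(y)$, $x[\mathsf{inl}]$, $x(\mathsf{inl})$, $x[\mathsf{inr}]$, $x(\mathsf{inr})$, ${?}x[y]$, ${!}x(y)$, ${?}x[x_1,x_2]$, ${!}x(x_1,x_2)$, ${?}x[]$, ${!}x()$, $x[A]$, $x(A)$. Labels: $\tau$, $x\leftrightarrow y$, $l$, and unordered pairs $l\parallel l'$, for $l,l'\in$ Act. In an action label $x$ is free and the names inside brackets are bound; both names of $x\leftrightarrow y$ are free; $\mathrm{fn},\mathrm{bn}$ of a pair are unions; $\mathrm{cn}(l)=\mathrm{fn}(l)\cup\mathrm{bn}(l)$. **Process transitions** (least relation closed under): $\pi.P\xrightarrow{\pi}P$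 for $\pi$ of the form $x[y],x(y),x[],x(),x[\mathsf{inl}],x[\mathsf{inr}],x[A],{?}x[y],{!}x(y)$; $x\triangleright(P,Q)\xrightarrow{x(\mathsf{inl})}P$; $x\triangleright(P,Q)\xrightarrow{x(\mathsf{inr})}Q$; $x(X).P\xrightarrow{x(A)}P\{A/X\}$; ${?}x[].P\xrightarrow{{?}x[]}x().P$; ${?}x[x_1,x_2].P\xrightarrow{{?}x[x_1,x_2]}x_1(x_2).P$; ${!}x(x').P\xrightarrow{{!}x()}{?}z_1[].\cdots{?}z_n[].x[].\mathbf 0$ if $\mathrm{fn}(P)\setminus\{x'\}=\{z_1,\ldots,z_n\}$; ${!}x(x').P\xrightarrow{{!}x(x_1,x_2)}{?}z_1[z_1\sigma_1,z_1\sigma_2].\cdots{?}z_n[z_n\sigma_1,z_n\sigma_2].x_1[x_2].({!}x_1(x'\sigma_1).P\sigma_1\parallel{!}x_2(x'\sigma_2).P\sigma_2)$ if $\sigma_1,\sigma_2$ are name substitutions with $\mathrm{fn}(P\sigma_1)\cap\mathrm{fn}(P\sigma_2)=\emptyset$ and $\mathrm{fn}(P)\setminus\{x'\}=\{z_1,\ldots,z_n\}$; $x\leftrightarrow y\xrightarrow{x\leftrightarrow y}\mathbf 0$ and $x\leftrightarrow y\xrightarrow{y\leftrightarrow x}\mathbf 0$. ($\alpha$) if $P=_\alpha Q$ and $Q\xrightarrow{l}R$ then $P\xrightarrow{l}R$. (Par) if $P\xrightarrow{l}P'$ and $\mathrm{bn}(l)\cap\mathrm{fn}(Q)=\emptyset$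 then $P\parallel Q\xrightarrow{l}P'\parallel Q$; symmetrically on the right. (Syn) if $P\xrightarrow{l}P'$, $Q\xrightarrow{l'}Q'$, $l,l'\in$ Act, $\mathrm{bn}(l)\cap\mathrm{bn}(l')=\emptyset$ then $P\parallel Q\xrightarrow{l\parallel l'}P'\parallel Q'$. (Res) if $P\xrightarrow{l}P'$ and $x,y\notin\mathrm{cn}(l)$ then $(\nu xy)P\xrightarrow{l}(\nu xy)P'$. (Communication) $(\nu xy)P\xrightarrow{\tau}R$ whenever $P\xrightarrow{m}P'$ and: $m=x[]\parallel y()$, $R=P'$; $m=x[x']\parallel y(y')$, $R=(\nu xy)(\nu x'y')P'$; $m=x[\mathsf{inl}]\parallel y(\mathsf{inl})$ or $m=x[\mathsf{inr}]\parallel y(\mathsf{inr})$ or $m=x[A]\parallel y(A)$ or $m={?}x[]\parallel{!}y()$, $R=(\nu xy)P'$; $m={?}x[x']\parallel{!}y(y')$, $R=(\nu x'y')P'$; $m={?}x[x_1,x_2]\parallel{!}y(y_1,y_2)$, $R=(\nu x_1y_1)P'$; $m=z\leftrightarrow y$ with $z\notin\{x,y\}$, $R=P'\{z/x\}$.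
   Formalization: Clashes of bound names are excluded, else the claim fails: (Syn) also requires bn(l)∩fn(Q)=∅ and bn(l′)∩fn(P)=∅; in the !x(x₁,x₂) rule the σᵢ are injective on fn(P), x₁≠x₂, x₁ is no zᵢ, x₁,x₂ are no zᵢσⱼ, and no zᵢσⱼ equals a later zₖ. -}

module Defs where

open import Data.List using (List; []; _∷_; [_]; _++_; map; filter; foldr; concat)
open import Data.List.Membership.Propositional using (_∈_; _∉_)
open import Data.List.Relation.Binary.BagAndSetEquality using (_∼[_]_; set)
open import Data.List.Relation.Binary.Disjoint.Propositional using (Disjoint)
open import Data.List.Relation.Binary.Permutation.Homogeneous using (Permutation)
open import Data.List.Relation.Binary.Permutation.Propositional using (_↭_)
open import Data.List.Relation.Unary.All using (All)
open import Data.List.Relation.Unary.AllPairs using (AllPairs)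
open import Data.List.Relation.Unary.Unique.Propositional using (Unique)
open import Data.Nat using (ℕ; zero; suc)
open import Data.Product using (∃; _×_; _,_; proj₁; proj₂; map₂)
open import Relation.Binary.Definitions using (DecidableEquality)
open import Relation.Binary.PropositionalEquality using (_≡_; _≢_)
open import Relation.Nullary using (yes; no)
open import Relation.Nullary.Decidable using (¬?)

------------------------------------------------------------------------
-- Types.  Type variables are de Bruijn indices (∃ᵗ, ∀ᵗ and the process
-- prefix x(X) bind index 0), so types, and processes as far as type
-- variables are concerned, are identified up to α-equivalence.  Indices
-- are not scoped: there is always an infinite supply of free variables.

infixr 8 _⊗_ _⅋_ _⊕_ _&_
infix  9 ∃ᵗ_ ∀ᵗ_ ⁇_ !_
infix 10 _^⊥

data Type : Set where
  _⊗_ _⅋_ _⊕_ _&_ : Type → Type → Type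
  𝟏 ⊥ᵗ            : Type
  var var⊥        : ℕ → Type
  ∃ᵗ_ ∀ᵗ_         : Type → Type
  ⁇_ !_           : Type → Type

_^⊥ : Type → Type
(A ⊗ B) ^⊥  = A ^⊥ ⅋ B ^⊥
(A ⅋ B) ^⊥  = A ^⊥ ⊗ B ^⊥
(A ⊕ B) ^⊥  = A ^⊥ & B ^⊥
(A & B) ^⊥  = A ^⊥ ⊕ B ^⊥
𝟏 ^⊥        = ⊥ᵗ
⊥ᵗ ^⊥       = 𝟏
(var X) ^⊥  = var⊥ X
(var⊥ X) ^⊥ = var X
(∃ᵗ A) ^⊥   = ∀ᵗ (A ^⊥)
(∀ᵗ A) ^⊥   = ∃ᵗ (A ^⊥)
(⁇ A) ^⊥    = ! (A ^⊥)
(! A) ^⊥    = ⁇ (A ^⊥)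

liftʳ : (ℕ → ℕ) → ℕ → ℕ
liftʳ ρ zero    = zero
liftʳ ρ (suc X) = suc (ρ X)

renᵗ : (ℕ → ℕ) → Type → Type
renᵗ ρ (A ⊗ B)  = renᵗ ρ A ⊗ renᵗ ρ B
renᵗ ρ (A ⅋ B)  = renᵗ ρ A ⅋ renᵗ ρ B
renᵗ ρ (A ⊕ B)  = renᵗ ρ A ⊕ renᵗ ρ B
renᵗ ρ (A & B)  = renᵗ ρ A & renᵗ ρ B
renᵗ ρ 𝟏        = 𝟏
renᵗ ρ ⊥ᵗ       = ⊥ᵗ
renᵗ ρ (var X)  = var (ρ X)
renᵗ ρ (var⊥ X) = var⊥ (ρ X)
renᵗ ρ (∃ᵗ A)   = ∃ᵗ renᵗ (liftʳ ρ) A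
renᵗ ρ (∀ᵗ A)   = ∀ᵗ renᵗ (liftʳ ρ) A
renᵗ ρ (⁇ A)    = ⁇ renᵗ ρ A
renᵗ ρ (! A)    = ! renᵗ ρ A

lift : (ℕ → Type) → ℕ → Type
lift θ zero    = var zero
lift θ (suc X) = renᵗ suc (θ X)

subᵗ : (ℕ → Type) → Type → Type
subᵗ θ (A ⊗ B)  = subᵗ θ A ⊗ subᵗ θ B
subᵗ θ (A ⅋ B)  = subᵗ θ A ⅋ subᵗ θ B
subᵗ θ (A ⊕ B)  = subᵗ θ A ⊕ subᵗ θ B
subᵗ θ (A & B)  = subᵗ θ A & subᵗ θ B
subᵗ θ 𝟏        = 𝟏
subᵗ θ ⊥ᵗ       = ⊥ᵗ
subᵗ θ (var X)  = θ X
subᵗ θ (var⊥ X) = θ X ^⊥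
subᵗ θ (∃ᵗ A)   = ∃ᵗ subᵗ (lift θ) A
subᵗ θ (∀ᵗ A)   = ∀ᵗ subᵗ (lift θ) A
subᵗ θ (⁇ A)    = ⁇ subᵗ θ A
subᵗ θ (! A)    = ! subᵗ θ A

single : Type → ℕ → Type
single A zero    = A
single A (suc X) = var X

-- B{A/X}, where X is the variable with index 0 in B.
_[_]ᵗ : Type → Type → Type
B [ A ]ᵗ = subᵗ (single A) B

------------------------------------------------------------------------
-- Infinity of the set of names is given by the possibility of choosing a
-- name outside any finite list.

record Names : Set₁ where
  infix 4 _≟_
  field
    Name  : Set
    _≟_   : DecidableEquality Name
    fresh : (xs : List Name) → ∃ λ x → x ∉ xs

module πLL (𝒩 : Names) where

  open Names 𝒩

  -- Square brackets are written ⟦ ⟧ and round ones ⦅ ⦆; a leading ? or !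
  -- moves behind the subject, e.g. ?x[y].P is  x ?⟦ y ⟧· P.  In the
  -- prefixes with a superscript ᵗ the object is a type; x(X).P is
  -- x ⦅X⦆· P, where index 0 stands for X in P.
  infixr 6 _⟦_⟧·_ _⦅_⦆·_ _⟦⟧·_ _⦅⦆·_ _⟦inl⟧·_ _⟦inr⟧·_ _⟦_⟧ᵗ·_ _⦅X⦆·_
  infixr 6 _!⦅_⦆·_ _?⟦_⟧·_ _?⟦_∣_⟧·_ _?⟦⟧·_ ⦅ν_∣_⦆_
  infix  7 _↔_ _▹⦅_∣_⦆
  infixr 5 _∥_

  data Proc : Set where
    _⟦_⟧·_     : Name → Name → Proc → Proc
    _⦅_⦆·_     : Name → Name → Proc → Proc
    _⟦⟧·_      : Name → Proc → Proc
    _⦅⦆·_      : Name → Proc → Proc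
    _⟦inl⟧·_   : Name → Proc → Proc
    _⟦inr⟧·_   : Name → Proc → Proc
    _▹⦅_∣_⦆    : Name → Proc → Proc → Proc
    _⟦_⟧ᵗ·_    : Name → Type → Proc → Proc
    _⦅X⦆·_     : Name → Proc → Proc
    _!⦅_⦆·_    : Name → Name → Proc → Proc
    _?⟦_⟧·_    : Name → Name → Proc → Proc
    _?⟦_∣_⟧·_  : Name → Name → Name → Proc → Proc
    _?⟦⟧·_     : Name → Proc → Proc
    ⦅ν_∣_⦆_    : Name → Name → Proc → Proc
    _∥_        : Proc → Proc → Proc
    𝟎          : Proc
    _↔_        : Name → Name → Proc

  infixl 7 _∖_

  _∖_ : List Name → Name → List Name
  xs ∖ y = filter (λ z → ¬? (z ≟ y)) xs

  fn : Proc → List Name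
  fn (x ⟦ y ⟧· P)        = x ∷ fn P ∖ y
  fn (x ⦅ y ⦆· P)        = x ∷ fn P ∖ y
  fn (x ⟦⟧· P)           = x ∷ fn P
  fn (x ⦅⦆· P)           = x ∷ fn P
  fn (x ⟦inl⟧· P)        = x ∷ fn P
  fn (x ⟦inr⟧· P)        = x ∷ fn P
  fn (x ▹⦅ P ∣ Q ⦆)      = x ∷ fn P ++ fn Q
  fn (x ⟦ A ⟧ᵗ· P)       = x ∷ fn P
  fn (x ⦅X⦆· P)          = x ∷ fn P
  fn (x !⦅ y ⦆· P)       = x ∷ fn P ∖ y
  fn (x ?⟦ y ⟧· P)       = x ∷ fn P ∖ y
  fn (x ?⟦ x₁ ∣ x₂ ⟧· P) = x ∷ fn P ∖ x₁ ∖ x₂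
  fn (x ?⟦⟧· P)          = x ∷ fn P
  fn (⦅ν x ∣ y ⦆ P)      = fn P ∖ x ∖ y
  fn (P ∥ Q)             = fn P ++ fn Q
  fn 𝟎                   = []
  fn (x ↔ y)             = x ∷ y ∷ []

  ----------------------------------------------------------------------
  -- Substitutions on processes

  subᵖ : (ℕ → Type) → Proc → Proc
  subᵖ θ (x ⟦ y ⟧· P)        = x ⟦ y ⟧· subᵖ θ P
  subᵖ θ (x ⦅ y ⦆· P)        = x ⦅ y ⦆· subᵖ θ P
  subᵖ θ (x ⟦⟧· P)           = x ⟦⟧· subᵖ θ P
  subᵖ θ (x ⦅⦆· P)           = x ⦅⦆· subᵖ θ P
  subᵖ θ (x ⟦inl⟧· P)        = x ⟦inl⟧· subᵖ θ P
  subᵖ θ (x ⟦inr⟧· P)        = x ⟦inr⟧· subᵖ θ P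
  subᵖ θ (x ▹⦅ P ∣ Q ⦆)      = x ▹⦅ subᵖ θ P ∣ subᵖ θ Q ⦆
  subᵖ θ (x ⟦ A ⟧ᵗ· P)       = x ⟦ subᵗ θ A ⟧ᵗ· subᵖ θ P
  subᵖ θ (x ⦅X⦆· P)          = x ⦅X⦆· subᵖ (lift θ) P
  subᵖ θ (x !⦅ y ⦆· P)       = x !⦅ y ⦆· subᵖ θ P
  subᵖ θ (x ?⟦ y ⟧· P)       = x ?⟦ y ⟧· subᵖ θ P
  subᵖ θ (x ?⟦ x₁ ∣ x₂ ⟧· P) = x ?⟦ x₁ ∣ x₂ ⟧· subᵖ θ P
  subᵖ θ (x ?⟦⟧· P)          = x ?⟦⟧· subᵖ θ P
  subᵖ θ (⦅ν x ∣ y ⦆ P)      = ⦅ν x ∣ y ⦆ subᵖ θ P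
  subᵖ θ (P ∥ Q)             = subᵖ θ P ∥ subᵖ θ Q
  subᵖ θ 𝟎                   = 𝟎
  subᵖ θ (x ↔ y)             = x ↔ y

  _[_]ᵖ : Proc → Type → Proc
  P [ A ]ᵖ = subᵖ (single A) P

  infixl 20 _[_↦_]

  _[_↦_] : (Name → Name) → Name → Name → Name → Name
  (σ [ y ↦ z ]) w with w ≟ y
  ... | yes _ = z
  ... | no  _ = σ w

  open import Data.List.Membership.DecPropositional _≟_ using (_∈?_)

  -- y itself unless it has to be avoided.
  pick : Name → List Name → Name
  pick y xs with y ∈? xs
  ... | yes _ = proj₁ (fresh xs)
  ... | no  _ = y

  -- Simultaneous capture-avoiding substitution of names for names.
  sub : (Name → Name) → Proc → Proc
  sub σ (x ⟦ y ⟧· P) =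
    let y′ = pick y (map σ (fn P ∖ y))
    in  σ x ⟦ y′ ⟧· sub (σ [ y ↦ y′ ]) P
  sub σ (x ⦅ y ⦆· P) =
    let y′ = pick y (map σ (fn P ∖ y))
    in  σ x ⦅ y′ ⦆· sub (σ [ y ↦ y′ ]) P
  sub σ (x ⟦⟧· P)           = σ x ⟦⟧· sub σ P
  sub σ (x ⦅⦆· P)           = σ x ⦅⦆· sub σ P
  sub σ (x ⟦inl⟧· P)        = σ x ⟦inl⟧· sub σ P
  sub σ (x ⟦inr⟧· P)        = σ x ⟦inr⟧· sub σ P
  sub σ (x ▹⦅ P ∣ Q ⦆)      = σ x ▹⦅ sub σ P ∣ sub σ Q ⦆
  sub σ (x ⟦ A ⟧ᵗ· P)       = σ x ⟦ A ⟧ᵗ· sub σ P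
  sub σ (x ⦅X⦆· P)          = σ x ⦅X⦆· sub σ P
  sub σ (x !⦅ y ⦆· P) =
    let y′ = pick y (map σ (fn P ∖ y))
    in  σ x !⦅ y′ ⦆· sub (σ [ y ↦ y′ ]) P
  sub σ (x ?⟦ y ⟧· P) =
    let y′ = pick y (map σ (fn P ∖ y))
    in  σ x ?⟦ y′ ⟧· sub (σ [ y ↦ y′ ]) P
  sub σ (x ?⟦ x₁ ∣ x₂ ⟧· P) =
    let x₁′ = pick x₁ (map σ (fn P ∖ x₁ ∖ x₂))
        x₂′ = pick x₂ (x₁′ ∷ map σ (fn P ∖ x₁ ∖ x₂))
    in  σ x ?⟦ x₁′ ∣ x₂′ ⟧· sub (σ [ x₁ ↦ x₁′ ] [ x₂ ↦ x₂′ ]) P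
  sub σ (x ?⟦⟧· P)          = σ x ?⟦⟧· sub σ P
  sub σ (⦅ν x ∣ y ⦆ P) =
    let x′ = pick x (map σ (fn P ∖ x ∖ y))
        y′ = pick y (x′ ∷ map σ (fn P ∖ x ∖ y))
    in  ⦅ν x′ ∣ y′ ⦆ sub (σ [ x ↦ x′ ] [ y ↦ y′ ]) P
  sub σ (P ∥ Q)             = sub σ P ∥ sub σ Q
  sub σ 𝟎                   = 𝟎
  sub σ (x ↔ y)             = σ x ↔ σ y

  -- P [ z / x ] is P{z/x}.
  _[_/_] : Proc → Name → Name → Proc
  P [ z / x ] = sub ((λ w → w) [ x ↦ z ]) P

  ----------------------------------------------------------------------
  -- α-equivalence

  swap : Name → Name → Name → Name
  swap a b x with x ≟ a | x ≟ b
  ... | yes _ | _     = b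
  ... | no  _ | yes _ = a
  ... | no  _ | no  _ = x

  -- Replacement of names in all positions, binders included.
  replace : (Name → Name) → Proc → Proc
  replace s (x ⟦ y ⟧· P)        = s x ⟦ s y ⟧· replace s P
  replace s (x ⦅ y ⦆· P)        = s x ⦅ s y ⦆· replace s P
  replace s (x ⟦⟧· P)           = s x ⟦⟧· replace s P
  replace s (x ⦅⦆· P)           = s x ⦅⦆· replace s P
  replace s (x ⟦inl⟧· P)        = s x ⟦inl⟧· replace s P
  replace s (x ⟦inr⟧· P)        = s x ⟦inr⟧· replace s P
  replace s (x ▹⦅ P ∣ Q ⦆)      = s x ▹⦅ replace s P ∣ replace s Q ⦆
  replace s (x ⟦ A ⟧ᵗ· P)       = s x ⟦ A ⟧ᵗ· replace s P
  replace s (x ⦅X⦆· P)          = s x ⦅X⦆· replace s P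
  replace s (x !⦅ y ⦆· P)       = s x !⦅ s y ⦆· replace s P
  replace s (x ?⟦ y ⟧· P)       = s x ?⟦ s y ⟧· replace s P
  replace s (x ?⟦ x₁ ∣ x₂ ⟧· P) = s x ?⟦ s x₁ ∣ s x₂ ⟧· replace s P
  replace s (x ?⟦⟧· P)          = s x ?⟦⟧· replace s P
  replace s (⦅ν x ∣ y ⦆ P)      = ⦅ν s x ∣ s y ⦆ replace s P
  replace s (P ∥ Q)             = replace s P ∥ replace s Q
  replace s 𝟎                   = 𝟎
  replace s (x ↔ y)             = s x ↔ s y

  ⟨_⇄_⟩_ : Name → Name → Proc → Proc
  ⟨ a ⇄ b ⟩ P = replace (swap a b) P

  infix 4 _=α_

  -- The least congruence that allows renaming a bound name y to a name z
  -- not free in the continuation P; for such z, transposing y and z in all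
  -- positions of P is renaming y to z without capture.
  -- ν-comm is the identification of (νxy)P with (νyx)P.
  data _=α_ : Proc → Proc → Set where
    α-⟦⟧    : ∀ {x y z P} → z ∉ fn P → x ⟦ y ⟧· P =α x ⟦ z ⟧· ⟨ y ⇄ z ⟩ P
    α-⦅⦆    : ∀ {x y z P} → z ∉ fn P → x ⦅ y ⦆· P =α x ⦅ z ⦆· ⟨ y ⇄ z ⟩ P
    α-!     : ∀ {x y z P} → z ∉ fn P → x !⦅ y ⦆· P =α x !⦅ z ⦆· ⟨ y ⇄ z ⟩ P
    α-?     : ∀ {x y z P} → z ∉ fn P → x ?⟦ y ⟧· P =α x ?⟦ z ⟧· ⟨ y ⇄ z ⟩ P
    α-?₁    : ∀ {x x₁ x₂ z P} → x₁ ≢ x₂ → z ≢ x₂ → z ∉ fn P →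
              x ?⟦ x₁ ∣ x₂ ⟧· P =α x ?⟦ z ∣ x₂ ⟧· ⟨ x₁ ⇄ z ⟩ P
    α-?₂    : ∀ {x x₁ x₂ z P} → x₁ ≢ x₂ → z ≢ x₁ → z ∉ fn P →
              x ?⟦ x₁ ∣ x₂ ⟧· P =α x ?⟦ x₁ ∣ z ⟧· ⟨ x₂ ⇄ z ⟩ P
    α-ν     : ∀ {x y z P} → x ≢ y → z ≢ y → z ∉ fn P →
              ⦅ν x ∣ y ⦆ P =α ⦅ν z ∣ y ⦆ ⟨ x ⇄ z ⟩ P
    ν-comm  : ∀ {x y P} → ⦅ν x ∣ y ⦆ P =α ⦅ν y ∣ x ⦆ P
    α-refl  : ∀ {P} → P =α P
    α-sym   : ∀ {P Q} → P =α Q → Q =α P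
    α-trans : ∀ {P Q R} → P =α Q → Q =α R → P =α R
    c-⟦⟧    : ∀ {x y P Q} → P =α Q → x ⟦ y ⟧· P =α x ⟦ y ⟧· Q
    c-⦅⦆    : ∀ {x y P Q} → P =α Q → x ⦅ y ⦆· P =α x ⦅ y ⦆· Q
    c-1     : ∀ {x P Q} → P =α Q → x ⟦⟧· P =α x ⟦⟧· Q
    c-⊥     : ∀ {x P Q} → P =α Q → x ⦅⦆· P =α x ⦅⦆· Q
    c-inl   : ∀ {x P Q} → P =α Q → x ⟦inl⟧· P =α x ⟦inl⟧· Q
    c-inr   : ∀ {x P Q} → P =α Q → x ⟦inr⟧· P =α x ⟦inr⟧· Q
    c-▹     : ∀ {x P P′ Q Q′} → P =α P′ → Q =α Q′ → x ▹⦅ P ∣ Q ⦆ =α x ▹⦅ P′ ∣ Q′ ⦆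
    c-∃     : ∀ {x A P Q} → P =α Q → x ⟦ A ⟧ᵗ· P =α x ⟦ A ⟧ᵗ· Q
    c-∀     : ∀ {x P Q} → P =α Q → x ⦅X⦆· P =α x ⦅X⦆· Q
    c-!     : ∀ {x y P Q} → P =α Q → x !⦅ y ⦆· P =α x !⦅ y ⦆· Q
    c-?     : ∀ {x y P Q} → P =α Q → x ?⟦ y ⟧· P =α x ?⟦ y ⟧· Q
    c-C     : ∀ {x x₁ x₂ P Q} → P =α Q → x ?⟦ x₁ ∣ x₂ ⟧· P =α x ?⟦ x₁ ∣ x₂ ⟧· Q
    c-W     : ∀ {x P Q} → P =α Q → x ?⟦⟧· P =α x ?⟦⟧· Q
    c-ν     : ∀ {x y P Q} → P =α Q → ⦅ν x ∣ y ⦆ P =α ⦅ν x ∣ y ⦆ Q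
    c-∥     : ∀ {P P′ Q Q′} → P =α P′ → Q =α Q′ → P ∥ Q =α P′ ∥ Q′

  ----------------------------------------------------------------------
  -- Typing.  Environments and hyperenvironments are lists, taken up to
  -- reordering by the rule exch.  The side conditions ensure that all names
  -- in a derivable judgement are distinct; where a rule has none,
  -- distinctness is inherited from its premises.

  Env : Set
  Env = List (Name × Type)

  HEnv : Set
  HEnv = List Env

  dom : Env → List Name
  dom = map proj₁

  names : HEnv → List Name
  names 𝒢 = dom (concat 𝒢)

  infix 4 _≋_

  _≋_ : HEnv → HEnv → Set
  _≋_ = Permutation _↭_

  AllWhyNot : Env → Set
  AllWhyNot = All (λ (_ , A) → ∃ λ B → A ≡ ⁇ B)

  -- Passes below a binder of a type variable; a type in the image does not
  -- contain the bound variable.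
  weaken : Env → Env
  weaken = map (map₂ (renᵗ suc))

  infix 3 ⊢_⦂_

  data ⊢_⦂_ : Proc → HEnv → Set where
    exch : ∀ {P 𝒢 ℋ} → 𝒢 ≋ ℋ → ⊢ P ⦂ 𝒢 → ⊢ P ⦂ ℋ
    ax   : ∀ {x y A} → x ≢ y → ⊢ x ↔ y ⦂ [ (x , A ^⊥) ∷ (y , A) ∷ [] ]
    cut  : ∀ {P 𝒢 Γ Δ x y A} →
           ⊢ P ⦂ ((x , A) ∷ Γ) ∷ ((y , A ^⊥) ∷ Δ) ∷ 𝒢 →
           ⊢ ⦅ν x ∣ y ⦆ P ⦂ (Γ ++ Δ) ∷ 𝒢
    mix  : ∀ {P Q 𝒢 ℋ} → Disjoint (names 𝒢) (names ℋ) →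
           ⊢ P ⦂ 𝒢 → ⊢ Q ⦂ ℋ → ⊢ P ∥ Q ⦂ 𝒢 ++ ℋ
    mix₀ : ⊢ 𝟎 ⦂ []
    ⊗-I  : ∀ {P Γ Δ x y A B} →
           ⊢ P ⦂ ((y , A) ∷ Γ) ∷ ((x , B) ∷ Δ) ∷ [] →
           ⊢ x ⟦ y ⟧· P ⦂ [ (x , A ⊗ B) ∷ Γ ++ Δ ]
    1-I  : ∀ {P x} → ⊢ P ⦂ [] → ⊢ x ⟦⟧· P ⦂ [ [ (x , 𝟏) ] ]
    ⅋-I  : ∀ {P Γ x y A B} →
           ⊢ P ⦂ [ (y , A) ∷ (x , B) ∷ Γ ] →
           ⊢ x ⦅ y ⦆· P ⦂ [ (x , A ⅋ B) ∷ Γ ]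
    ⊥-I  : ∀ {P Γ x} → x ∉ dom Γ →
           ⊢ P ⦂ [ Γ ] → ⊢ x ⦅⦆· P ⦂ [ (x , ⊥ᵗ) ∷ Γ ]
    ⊕-I₁ : ∀ {P Γ x A B} →
           ⊢ P ⦂ [ (x , A) ∷ Γ ] → ⊢ x ⟦inl⟧· P ⦂ [ (x , A ⊕ B) ∷ Γ ]
    ⊕-I₂ : ∀ {P Γ x A B} →
           ⊢ P ⦂ [ (x , B) ∷ Γ ] → ⊢ x ⟦inr⟧· P ⦂ [ (x , A ⊕ B) ∷ Γ ]
    &-I  : ∀ {P Q Γ x A B} →
           ⊢ P ⦂ [ (x , A) ∷ Γ ] → ⊢ Q ⦂ [ (x , B) ∷ Γ ] →
           ⊢ x ▹⦅ P ∣ Q ⦆ ⦂ [ (x , A & B) ∷ Γ ]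
    !-I  : ∀ {P Γ x y A} → AllWhyNot Γ → x ∉ dom Γ →
           ⊢ P ⦂ [ (y , A) ∷ Γ ] → ⊢ x !⦅ y ⦆· P ⦂ [ (x , ! A) ∷ Γ ]
    ?-I  : ∀ {P Γ x y A} → x ∉ dom Γ →
           ⊢ P ⦂ [ (y , A) ∷ Γ ] → ⊢ x ?⟦ y ⟧· P ⦂ [ (x , ⁇ A) ∷ Γ ]
    W    : ∀ {P Γ x A} → x ∉ dom Γ →
           ⊢ P ⦂ [ Γ ] → ⊢ x ?⟦⟧· P ⦂ [ (x , ⁇ A) ∷ Γ ]
    C    : ∀ {P Γ x x₁ x₂ A} → x ∉ dom Γ →
           ⊢ P ⦂ [ (x₁ , ⁇ A) ∷ (x₂ , ⁇ A) ∷ Γ ] →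
           ⊢ x ?⟦ x₁ ∣ x₂ ⟧· P ⦂ [ (x , ⁇ A) ∷ Γ ]
    ∃-I  : ∀ {P Γ x A B} →
           ⊢ P ⦂ [ (x , B [ A ]ᵗ) ∷ Γ ] → ⊢ x ⟦ A ⟧ᵗ· P ⦂ [ (x , ∃ᵗ B) ∷ Γ ]
    ∀-I  : ∀ {P Γ x B} →
           ⊢ P ⦂ [ (x , B) ∷ weaken Γ ] → ⊢ x ⦅X⦆· P ⦂ [ (x , ∀ᵗ B) ∷ Γ ]

  WellTyped : Proc → Set
  WellTyped P = ∃ λ 𝒢 → ⊢ P ⦂ 𝒢

  ----------------------------------------------------------------------
  -- Labels

  infix 7 _⟦⟧ _⦅⦆ _⟦_⟧ _⦅_⦆ _⟦inl⟧ _⦅inl⦆ _⟦inr⟧ _⦅inr⦆ _?⟦_⟧ _!⦅_⦆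
  infix 7 _?⟦_∣_⟧ _!⦅_∣_⦆ _?⟦⟧ _!⦅⦆ _⟦_⟧ᵗ _⦅_⦆ᵗ

  data Act : Set where
    _⟦⟧ _⦅⦆                     : Name → Act
    _⟦_⟧ _⦅_⦆                   : Name → Name → Act
    _⟦inl⟧ _⦅inl⦆ _⟦inr⟧ _⦅inr⦆ : Name → Act
    _?⟦_⟧ _!⦅_⦆                 : Name → Name → Act
    _?⟦_∣_⟧ _!⦅_∣_⦆             : Name → Name → Name → Act
    _?⟦⟧ _!⦅⦆                   : Name → Act
    _⟦_⟧ᵗ _⦅_⦆ᵗ                 : Name → Type → Act

  -- Pairs are ordered here; the transition rule pair-comm makes them
  -- unordered.
  data Label : Set where
    τ    : Label
    _↔_  : Name → Name → Label
    act  : Act → Label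
    _∥_  : Act → Act → Label

  subject : Act → Name
  subject (x ⟦⟧)            = x
  subject (x ⦅⦆)            = x
  subject (x ⟦ _ ⟧)         = x
  subject (x ⦅ _ ⦆)         = x
  subject (x ⟦inl⟧)         = x
  subject (x ⦅inl⦆)         = x
  subject (x ⟦inr⟧)         = x
  subject (x ⦅inr⦆)         = x
  subject (x ?⟦ _ ⟧)        = x
  subject (x !⦅ _ ⦆)        = x
  subject (x ?⟦ _ ∣ _ ⟧)    = x
  subject (x !⦅ _ ∣ _ ⦆)    = x
  subject (x ?⟦⟧)           = x
  subject (x !⦅⦆)           = x
  subject (x ⟦ _ ⟧ᵗ)        = x
  subject (x ⦅ _ ⦆ᵗ)        = x

  bnᵃ : Act → List Name
  bnᵃ (_ ⟦ y ⟧)         = [ y ]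
  bnᵃ (_ ⦅ y ⦆)         = [ y ]
  bnᵃ (_ ?⟦ y ⟧)        = [ y ]
  bnᵃ (_ !⦅ y ⦆)        = [ y ]
  bnᵃ (_ ?⟦ x₁ ∣ x₂ ⟧)  = x₁ ∷ x₂ ∷ []
  bnᵃ (_ !⦅ x₁ ∣ x₂ ⦆)  = x₁ ∷ x₂ ∷ []
  bnᵃ (_ ⟦⟧)            = []
  bnᵃ (_ ⦅⦆)            = []
  bnᵃ (_ ⟦inl⟧)         = []
  bnᵃ (_ ⦅inl⦆)         = []
  bnᵃ (_ ⟦inr⟧)         = []
  bnᵃ (_ ⦅inr⦆)         = []
  bnᵃ (_ ?⟦⟧)           = []
  bnᵃ (_ !⦅⦆)           = []
  bnᵃ (_ ⟦ _ ⟧ᵗ)        = []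
  bnᵃ (_ ⦅ _ ⦆ᵗ)        = []

  fnˡ : Label → List Name
  fnˡ τ        = []
  fnˡ (x ↔ y)  = x ∷ y ∷ []
  fnˡ (act l)  = [ subject l ]
  fnˡ (l ∥ l′) = subject l ∷ subject l′ ∷ []

  bnˡ : Label → List Name
  bnˡ τ        = []
  bnˡ (x ↔ y)  = []
  bnˡ (act l)  = bnᵃ l
  bnˡ (l ∥ l′) = bnᵃ l ++ bnᵃ l′

  cn : Label → List Name
  cn l = fnˡ l ++ bnˡ l

  ----------------------------------------------------------------------
  -- Transitions

  InjectiveOn : List Name → (Name → Name) → Set
  InjectiveOn xs σ = ∀ {x y} → x ∈ xs → y ∈ xs → σ x ≡ σ y → x ≡ y

  -- ?z₁[]. ⋯ ?zₙ[].Q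
  discard : List Name → Proc → Proc
  discard zs Q = foldr (λ z R → z ?⟦⟧· R) Q zs

  -- ?z₁[z₁σ₁,z₁σ₂]. ⋯ ?zₙ[zₙσ₁,zₙσ₂].Q
  duplicate : (Name → Name) → (Name → Name) → List Name → Proc → Proc
  duplicate σ₁ σ₂ zs Q = foldr (λ z R → z ?⟦ σ₁ z ∣ σ₂ z ⟧· R) Q zs

  infix 3 _—[_]→_

  data _—[_]→_ : Proc → Label → Proc → Set where
    out    : ∀ {x y P} → x ⟦ y ⟧· P —[ act (x ⟦ y ⟧) ]→ P
    inp    : ∀ {x y P} → x ⦅ y ⦆· P —[ act (x ⦅ y ⦆) ]→ P
    close  : ∀ {x P} → x ⟦⟧· P —[ act (x ⟦⟧) ]→ P
    wait   : ∀ {x P} → x ⦅⦆· P —[ act (x ⦅⦆) ]→ P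
    inl    : ∀ {x P} → x ⟦inl⟧· P —[ act (x ⟦inl⟧) ]→ P
    inr    : ∀ {x P} → x ⟦inr⟧· P —[ act (x ⟦inr⟧) ]→ P
    outᵗ   : ∀ {x A P} → x ⟦ A ⟧ᵗ· P —[ act (x ⟦ A ⟧ᵗ) ]→ P
    use    : ∀ {x y P} → x ?⟦ y ⟧· P —[ act (x ?⟦ y ⟧) ]→ P
    serve  : ∀ {x y P} → x !⦅ y ⦆· P —[ act (x !⦅ y ⦆) ]→ P
    case₁  : ∀ {x P Q} → x ▹⦅ P ∣ Q ⦆ —[ act (x ⦅inl⦆) ]→ P
    case₂  : ∀ {x P Q} → x ▹⦅ P ∣ Q ⦆ —[ act (x ⦅inr⦆) ]→ Q
    inpᵗ   : ∀ {x P} A → x ⦅X⦆· P —[ act (x ⦅ A ⦆ᵗ) ]→ P [ A ]ᵖ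
    disp   : ∀ {x P} → x ?⟦⟧· P —[ act (x ?⟦⟧) ]→ x ⦅⦆· P
    dup    : ∀ {x x₁ x₂ P} →
             x ?⟦ x₁ ∣ x₂ ⟧· P —[ act (x ?⟦ x₁ ∣ x₂ ⟧) ]→ x₁ ⦅ x₂ ⦆· P
    !disp  : ∀ {x x′ P} zs → Unique zs → zs ∼[ set ] (fn P ∖ x′) →
             x !⦅ x′ ⦆· P —[ act (x !⦅⦆) ]→ discard zs (x ⟦⟧· 𝟎)

    -- The premises after the disjointness of fn(Pσ₁) and fn(Pσ₂) spell out
    -- the convention that bound names do not clash: the σᵢ do not identify
    -- free names of P; the bound names x₁, x₂ of the label are distinct, and
    -- x₁ is not one of the zs, which are free in both source and target;
    -- the binders zσᵢ of the target capture neither x₁, x₂ nor a later z′.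
    !dup   : ∀ {x x′ x₁ x₂ P} σ₁ σ₂ zs → Unique zs → zs ∼[ set ] (fn P ∖ x′) →
             Disjoint (fn (sub σ₁ P)) (fn (sub σ₂ P)) →
             InjectiveOn (fn P) σ₁ → InjectiveOn (fn P) σ₂ →
             x₁ ≢ x₂ → x₁ ∉ zs →
             Disjoint (x₁ ∷ x₂ ∷ []) (map σ₁ zs ++ map σ₂ zs) →
             AllPairs (λ z z′ → σ₁ z ≢ z′ × σ₂ z ≢ z′) zs →
             x !⦅ x′ ⦆· P —[ act (x !⦅ x₁ ∣ x₂ ⦆) ]→
             duplicate σ₁ σ₂ zs
               (x₁ ⟦ x₂ ⟧· (x₁ !⦅ σ₁ x′ ⦆· sub σ₁ P ∥ x₂ !⦅ σ₂ x′ ⦆· sub σ₂ P))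

    fwd₁   : ∀ {x y} → x ↔ y —[ x ↔ y ]→ 𝟎
    fwd₂   : ∀ {x y} → x ↔ y —[ y ↔ x ]→ 𝟎

    alpha  : ∀ {P Q R l} → P =α Q → Q —[ l ]→ R → P —[ l ]→ R
    par₁   : ∀ {P P′ Q l} → Disjoint (bnˡ l) (fn Q) →
             P —[ l ]→ P′ → P ∥ Q —[ l ]→ P′ ∥ Q
    par₂   : ∀ {P Q Q′ l} → Disjoint (bnˡ l) (fn P) →
             Q —[ l ]→ Q′ → P ∥ Q —[ l ]→ P ∥ Q′

    -- As in par₁ and par₂, the bound names of the label of one component are
    -- not free in the other one.
    syn    : ∀ {P P′ Q Q′ l l′} → Disjoint (bnᵃ l) (bnᵃ l′) →
             Disjoint (bnᵃ l) (fn Q) → Disjoint (bnᵃ l′) (fn P) →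
             P —[ act l ]→ P′ → Q —[ act l′ ]→ Q′ → P ∥ Q —[ l ∥ l′ ]→ P′ ∥ Q′

    pair-comm : ∀ {P P′ l l′} → P —[ l ∥ l′ ]→ P′ → P —[ l′ ∥ l ]→ P′

    res    : ∀ {P P′ x y l} → x ∉ cn l → y ∉ cn l →
             P —[ l ]→ P′ → ⦅ν x ∣ y ⦆ P —[ l ]→ ⦅ν x ∣ y ⦆ P′

    com-1  : ∀ {P P′ x y} → P —[ x ⟦⟧ ∥ y ⦅⦆ ]→ P′ →
             ⦅ν x ∣ y ⦆ P —[ τ ]→ P′
    com-⊗  : ∀ {P P′ x y x′ y′} → P —[ x ⟦ x′ ⟧ ∥ y ⦅ y′ ⦆ ]→ P′ →
             ⦅ν x ∣ y ⦆ P —[ τ ]→ ⦅ν x ∣ y ⦆ ⦅ν x′ ∣ y′ ⦆ P′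
    com-⊕₁ : ∀ {P P′ x y} → P —[ x ⟦inl⟧ ∥ y ⦅inl⦆ ]→ P′ →
             ⦅ν x ∣ y ⦆ P —[ τ ]→ ⦅ν x ∣ y ⦆ P′
    com-⊕₂ : ∀ {P P′ x y} → P —[ x ⟦inr⟧ ∥ y ⦅inr⦆ ]→ P′ →
             ⦅ν x ∣ y ⦆ P —[ τ ]→ ⦅ν x ∣ y ⦆ P′
    com-∃  : ∀ {P P′ x y A} → P —[ x ⟦ A ⟧ᵗ ∥ y ⦅ A ⦆ᵗ ]→ P′ →
             ⦅ν x ∣ y ⦆ P —[ τ ]→ ⦅ν x ∣ y ⦆ P′
    com-W  : ∀ {P P′ x y} → P —[ x ?⟦⟧ ∥ y !⦅⦆ ]→ P′ →
             ⦅ν x ∣ y ⦆ P —[ τ ]→ ⦅ν x ∣ y ⦆ P′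
    com-?  : ∀ {P P′ x y x′ y′} → P —[ x ?⟦ x′ ⟧ ∥ y !⦅ y′ ⦆ ]→ P′ →
             ⦅ν x ∣ y ⦆ P —[ τ ]→ ⦅ν x′ ∣ y′ ⦆ P′
    com-C  : ∀ {P P′ x y x₁ x₂ y₁ y₂} → P —[ x ?⟦ x₁ ∣ x₂ ⟧ ∥ y !⦅ y₁ ∣ y₂ ⦆ ]→ P′ →
             ⦅ν x ∣ y ⦆ P —[ τ ]→ ⦅ν x₁ ∣ y₁ ⦆ P′
    com-↔  : ∀ {P P′ x y z} → z ≢ x → z ≢ y → P —[ z ↔ y ]→ P′ →
             ⦅ν x ∣ y ⦆ P —[ τ ]→ P′ [ z / x ]

{-# OPTIONS --safe #-}

-- A transition of a typed process under an action or forwarder label is mirrored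
-- by a transition of its hyperenvironment: one environment loses the subject of
-- the label and is split among the environments that the label produces, all
-- others staying as they are.  Such a step commutes with the merging of two
-- environments in the rule cut, which gives the case of restriction.  A
-- transition under l ∥ l′ is a transition under l followed by one under l′, since
-- the bound names of either label are not free in the component performing the
-- other.  Hence a communication across a cut consists of two steps in the
-- distinct environments of the dual names x and y, after which the resulting
-- environments can be cut again; in particular τ preserves the typing itself.

module Submission where

open import Defs
open import Data.List using (List; []; _∷_; [_]; _++_; map; concat)
import Data.List.Membership.DecPropositional as DecMembership
open import Data.List.Membership.Propositional using (_∈_; _∉_)
open import Data.List.Membership.Propositional.Properties
  using (∈-filter⁺; ∈-filter⁻; ∈-++⁺ˡ; ∈-++⁺ʳ; ∈-++⁻; ∈-∃++; ∈-map⁺; ∈-map⁻)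
open import Data.List.Membership.Propositional.Properties.WithK using (unique∧set⇒bag)
open import Data.List.Properties
  using (map-++; ++-identityʳ; ++-assoc; map-∘; map-cong; map-id; concat-++)
open import Data.List.Relation.Binary.BagAndSetEquality using (_∼[_]_; set; ∼bag⇒↭)
open import Data.List.Relation.Binary.Disjoint.Propositional using (Disjoint)
import Data.List.Relation.Binary.Permutation.Homogeneous as Homogeneous
open import Data.List.Relation.Binary.Permutation.Propositional
  using (_↭_; ↭-setoid; ↭-sym; ↭-trans; ↭-refl; ↭-reflexive; ↭⇒↭ₛ; prep)
import Data.List.Relation.Binary.Permutation.Propositional.Properties as ↭
import Data.List.Relation.Binary.Permutation.Setoid as Setoid↭
import Data.List.Relation.Binary.Permutation.Setoid.Properties as Setoid↭ₚ
open import Data.List.Relation.Binary.Pointwise using (Pointwise; []; _∷_)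
open import Data.List.Relation.Unary.All as All using (All; []; _∷_)
import Data.List.Relation.Unary.All.Properties as All
open import Data.List.Relation.Unary.AllPairs using (AllPairs; []; _∷_)
open import Data.List.Relation.Unary.Any as Any using (Any; here; there)
import Data.List.Relation.Unary.Any.Properties as Any
open import Data.List.Relation.Unary.Unique.Propositional using (Unique)
import Data.List.Relation.Unary.Unique.Propositional.Properties as Unique
open import Data.Nat using (ℕ; zero; suc)
open import Data.Product using (∃; ∃-syntax; _×_; _,_; proj₁; proj₂; map₁; map₂)
open import Data.Sum using (_⊎_; inj₁; inj₂; [_,_]′)
open import Function using (_∘_)
open import Function.Bundles using (module Equivalence; mk⇔)
open import Relation.Binary.PropositionalEquality hiding ([_])
open import Relation.Nullary using (yes; no; contradiction)
open import Relation.Nullary.Decidable using (¬?)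

open Equivalence using (to; from)

-- Typability alone is too weak for the induction: below a restriction the residual must be cut
-- again, so its two names must still lie in distinct environments at dual types. This works because
-- a name that the label does not consume ends up in exactly one of the resulting environments, even
-- when an output splits its environment in two. A joint step for `l ∥ l′` would be awkward: an
-- inner cut may merge the environments of the two subjects, so that both labels act in a single
-- environment. Sequencing the labels avoids this. Its price is that the bound names of the second
-- label must be kept apart from the free names of an intermediate residual; these are under control
-- because a hyperenvironment names exactly the free names of the process that it types. Since
-- exchange is a rule of the type system, every inversion is an induction that first peels off
-- `exch`.

-- Duality, renaming and substitution of types

^⊥-involutive : ∀ A → A ^⊥ ^⊥ ≡ A
^⊥-involutive (A ⊗ B)  = cong₂ _⊗_ (^⊥-involutive A) (^⊥-involutive B)
^⊥-involutive (A ⅋ B)  = cong₂ _⅋_ (^⊥-involutive A) (^⊥-involutive B)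
^⊥-involutive (A ⊕ B)  = cong₂ _⊕_ (^⊥-involutive A) (^⊥-involutive B)
^⊥-involutive (A & B)  = cong₂ _&_ (^⊥-involutive A) (^⊥-involutive B)
^⊥-involutive 𝟏        = refl
^⊥-involutive ⊥ᵗ       = refl
^⊥-involutive (var X)  = refl
^⊥-involutive (var⊥ X) = refl
^⊥-involutive (∃ᵗ A)   = cong ∃ᵗ_ (^⊥-involutive A)
^⊥-involutive (∀ᵗ A)   = cong ∀ᵗ_ (^⊥-involutive A)
^⊥-involutive (⁇ A)    = cong ⁇_ (^⊥-involutive A)
^⊥-involutive (! A)    = cong !_ (^⊥-involutive A)

renᵗ-^⊥ : ∀ ρ A → renᵗ ρ (A ^⊥) ≡ renᵗ ρ A ^⊥
renᵗ-^⊥ ρ (A ⊗ B)  = cong₂ _⅋_ (renᵗ-^⊥ ρ A) (renᵗ-^⊥ ρ B)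
renᵗ-^⊥ ρ (A ⅋ B)  = cong₂ _⊗_ (renᵗ-^⊥ ρ A) (renᵗ-^⊥ ρ B)
renᵗ-^⊥ ρ (A ⊕ B)  = cong₂ _&_ (renᵗ-^⊥ ρ A) (renᵗ-^⊥ ρ B)
renᵗ-^⊥ ρ (A & B)  = cong₂ _⊕_ (renᵗ-^⊥ ρ A) (renᵗ-^⊥ ρ B)
renᵗ-^⊥ ρ 𝟏        = refl
renᵗ-^⊥ ρ ⊥ᵗ       = refl
renᵗ-^⊥ ρ (var X)  = refl
renᵗ-^⊥ ρ (var⊥ X) = refl
renᵗ-^⊥ ρ (∃ᵗ A)   = cong ∀ᵗ_ (renᵗ-^⊥ (liftʳ ρ) A)
renᵗ-^⊥ ρ (∀ᵗ A)   = cong ∃ᵗ_ (renᵗ-^⊥ (liftʳ ρ) A)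
renᵗ-^⊥ ρ (⁇ A)    = cong !_ (renᵗ-^⊥ ρ A)
renᵗ-^⊥ ρ (! A)    = cong ⁇_ (renᵗ-^⊥ ρ A)

subᵗ-^⊥ : ∀ θ A → subᵗ θ (A ^⊥) ≡ subᵗ θ A ^⊥
subᵗ-^⊥ θ (A ⊗ B)  = cong₂ _⅋_ (subᵗ-^⊥ θ A) (subᵗ-^⊥ θ B)
subᵗ-^⊥ θ (A ⅋ B)  = cong₂ _⊗_ (subᵗ-^⊥ θ A) (subᵗ-^⊥ θ B)
subᵗ-^⊥ θ (A ⊕ B)  = cong₂ _&_ (subᵗ-^⊥ θ A) (subᵗ-^⊥ θ B)
subᵗ-^⊥ θ (A & B)  = cong₂ _⊕_ (subᵗ-^⊥ θ A) (subᵗ-^⊥ θ B)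
subᵗ-^⊥ θ 𝟏        = refl
subᵗ-^⊥ θ ⊥ᵗ       = refl
subᵗ-^⊥ θ (var X)  = refl
subᵗ-^⊥ θ (var⊥ X) = sym (^⊥-involutive (θ X))
subᵗ-^⊥ θ (∃ᵗ A)   = cong ∀ᵗ_ (subᵗ-^⊥ (lift θ) A)
subᵗ-^⊥ θ (∀ᵗ A)   = cong ∃ᵗ_ (subᵗ-^⊥ (lift θ) A)
subᵗ-^⊥ θ (⁇ A)    = cong !_ (subᵗ-^⊥ θ A)
subᵗ-^⊥ θ (! A)    = cong ⁇_ (subᵗ-^⊥ θ A)

lift-renᵗ : ∀ ρ θ η → (∀ X → θ (ρ X) ≡ η X) → ∀ X → lift θ (liftʳ ρ X) ≡ lift η X
lift-renᵗ ρ θ η e zero    = refl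
lift-renᵗ ρ θ η e (suc X) = cong (renᵗ suc) (e X)

-- The composite is a separate `η` with a pointwise hypothesis because, under a binder,
-- `lift θ ∘ liftʳ ρ` and `lift (θ ∘ ρ)` agree only pointwise. The other composition laws have the
-- same form for this reason.
subᵗ-renᵗ : ∀ ρ θ η → (∀ X → θ (ρ X) ≡ η X) → ∀ A → subᵗ θ (renᵗ ρ A) ≡ subᵗ η A
subᵗ-renᵗ ρ θ η e (A ⊗ B)  = cong₂ _⊗_ (subᵗ-renᵗ ρ θ η e A) (subᵗ-renᵗ ρ θ η e B)
subᵗ-renᵗ ρ θ η e (A ⅋ B)  = cong₂ _⅋_ (subᵗ-renᵗ ρ θ η e A) (subᵗ-renᵗ ρ θ η e B)
subᵗ-renᵗ ρ θ η e (A ⊕ B)  = cong₂ _⊕_ (subᵗ-renᵗ ρ θ η e A) (subᵗ-renᵗ ρ θ η e B)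
subᵗ-renᵗ ρ θ η e (A & B)  = cong₂ _&_ (subᵗ-renᵗ ρ θ η e A) (subᵗ-renᵗ ρ θ η e B)
subᵗ-renᵗ ρ θ η e 𝟏        = refl
subᵗ-renᵗ ρ θ η e ⊥ᵗ       = refl
subᵗ-renᵗ ρ θ η e (var X)  = e X
subᵗ-renᵗ ρ θ η e (var⊥ X) = cong _^⊥ (e X)
subᵗ-renᵗ ρ θ η e (∃ᵗ A)   = cong ∃ᵗ_ (subᵗ-renᵗ (liftʳ ρ) (lift θ) (lift η) (lift-renᵗ ρ θ η e) A)
subᵗ-renᵗ ρ θ η e (∀ᵗ A)   = cong ∀ᵗ_ (subᵗ-renᵗ (liftʳ ρ) (lift θ) (lift η) (lift-renᵗ ρ θ η e) A)
subᵗ-renᵗ ρ θ η e (⁇ A)    = cong ⁇_ (subᵗ-renᵗ ρ θ η e A)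
subᵗ-renᵗ ρ θ η e (! A)    = cong !_ (subᵗ-renᵗ ρ θ η e A)

lift-var : ∀ θ → (∀ X → θ X ≡ var X) → ∀ X → lift θ X ≡ var X
lift-var θ e zero    = refl
lift-var θ e (suc X) = cong (renᵗ suc) (e X)

subᵗ-var : ∀ θ → (∀ X → θ X ≡ var X) → ∀ A → subᵗ θ A ≡ A
subᵗ-var θ e (A ⊗ B)  = cong₂ _⊗_ (subᵗ-var θ e A) (subᵗ-var θ e B)
subᵗ-var θ e (A ⅋ B)  = cong₂ _⅋_ (subᵗ-var θ e A) (subᵗ-var θ e B)
subᵗ-var θ e (A ⊕ B)  = cong₂ _⊕_ (subᵗ-var θ e A) (subᵗ-var θ e B)
subᵗ-var θ e (A & B)  = cong₂ _&_ (subᵗ-var θ e A) (subᵗ-var θ e B)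
subᵗ-var θ e 𝟏        = refl
subᵗ-var θ e ⊥ᵗ       = refl
subᵗ-var θ e (var X)  = e X
subᵗ-var θ e (var⊥ X) = cong _^⊥ (e X)
subᵗ-var θ e (∃ᵗ A)   = cong ∃ᵗ_ (subᵗ-var (lift θ) (lift-var θ e) A)
subᵗ-var θ e (∀ᵗ A)   = cong ∀ᵗ_ (subᵗ-var (lift θ) (lift-var θ e) A)
subᵗ-var θ e (⁇ A)    = cong ⁇_ (subᵗ-var θ e A)
subᵗ-var θ e (! A)    = cong !_ (subᵗ-var θ e A)

-- Obtained from the identity substitution without an induction of its own. Composites of renamings
-- thereby reduce to `subᵗ-renᵗ`.
renᵗ-as-subᵗ : ∀ ρ A → renᵗ ρ A ≡ subᵗ (var ∘ ρ) A
renᵗ-as-subᵗ ρ A =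
  trans (sym (subᵗ-var var (λ _ → refl) (renᵗ ρ A))) (subᵗ-renᵗ ρ var (var ∘ ρ) (λ _ → refl) A)

renᵗ-suc-comm : ∀ ρ A → renᵗ (liftʳ ρ) (renᵗ suc A) ≡ renᵗ suc (renᵗ ρ A)
renᵗ-suc-comm ρ A = begin
  renᵗ (liftʳ ρ) (renᵗ suc A)         ≡⟨ renᵗ-as-subᵗ (liftʳ ρ) (renᵗ suc A) ⟩
  subᵗ (var ∘ liftʳ ρ) (renᵗ suc A)   ≡⟨ subᵗ-renᵗ suc _ (var ∘ suc ∘ ρ) (λ _ → refl) A ⟩
  subᵗ (var ∘ suc ∘ ρ) A              ≡⟨ subᵗ-renᵗ ρ (var ∘ suc) _ (λ _ → refl) A ⟨
  subᵗ (var ∘ suc) (renᵗ ρ A)         ≡⟨ renᵗ-as-subᵗ suc (renᵗ ρ A) ⟨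
  renᵗ suc (renᵗ ρ A)                 ∎
  where open ≡-Reasoning

renᵗ-lift : ∀ ρ θ η → (∀ X → renᵗ ρ (θ X) ≡ η X) → ∀ X → renᵗ (liftʳ ρ) (lift θ X) ≡ lift η X
renᵗ-lift ρ θ η e zero    = refl
renᵗ-lift ρ θ η e (suc X) = trans (renᵗ-suc-comm ρ (θ X)) (cong (renᵗ suc) (e X))

renᵗ-subᵗ : ∀ ρ θ η → (∀ X → renᵗ ρ (θ X) ≡ η X) → ∀ A → renᵗ ρ (subᵗ θ A) ≡ subᵗ η A
renᵗ-subᵗ ρ θ η e (A ⊗ B)  = cong₂ _⊗_ (renᵗ-subᵗ ρ θ η e A) (renᵗ-subᵗ ρ θ η e B)
renᵗ-subᵗ ρ θ η e (A ⅋ B)  = cong₂ _⅋_ (renᵗ-subᵗ ρ θ η e A) (renᵗ-subᵗ ρ θ η e B)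
renᵗ-subᵗ ρ θ η e (A ⊕ B)  = cong₂ _⊕_ (renᵗ-subᵗ ρ θ η e A) (renᵗ-subᵗ ρ θ η e B)
renᵗ-subᵗ ρ θ η e (A & B)  = cong₂ _&_ (renᵗ-subᵗ ρ θ η e A) (renᵗ-subᵗ ρ θ η e B)
renᵗ-subᵗ ρ θ η e 𝟏        = refl
renᵗ-subᵗ ρ θ η e ⊥ᵗ       = refl
renᵗ-subᵗ ρ θ η e (var X)  = e X
renᵗ-subᵗ ρ θ η e (var⊥ X) = trans (renᵗ-^⊥ ρ (θ X)) (cong _^⊥ (e X))
renᵗ-subᵗ ρ θ η e (∃ᵗ A)   = cong ∃ᵗ_ (renᵗ-subᵗ (liftʳ ρ) (lift θ) (lift η) (renᵗ-lift ρ θ η e) A)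
renᵗ-subᵗ ρ θ η e (∀ᵗ A)   = cong ∀ᵗ_ (renᵗ-subᵗ (liftʳ ρ) (lift θ) (lift η) (renᵗ-lift ρ θ η e) A)
renᵗ-subᵗ ρ θ η e (⁇ A)    = cong ⁇_ (renᵗ-subᵗ ρ θ η e A)
renᵗ-subᵗ ρ θ η e (! A)    = cong !_ (renᵗ-subᵗ ρ θ η e A)

subᵗ-weaken : ∀ θ A → subᵗ (lift θ) (renᵗ suc A) ≡ renᵗ suc (subᵗ θ A)
subᵗ-weaken θ A = trans (subᵗ-renᵗ suc (lift θ) (renᵗ suc ∘ θ) (λ _ → refl) A)
                        (sym (renᵗ-subᵗ suc θ _ (λ _ → refl) A))

subᵗ-lift : ∀ θ η ξ → (∀ X → subᵗ θ (η X) ≡ ξ X) → ∀ X → subᵗ (lift θ) (lift η X) ≡ lift ξ X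
subᵗ-lift θ η ξ e zero    = refl
subᵗ-lift θ η ξ e (suc X) = trans (subᵗ-weaken θ (η X)) (cong (renᵗ suc) (e X))

subᵗ-subᵗ : ∀ θ η ξ → (∀ X → subᵗ θ (η X) ≡ ξ X) → ∀ A → subᵗ θ (subᵗ η A) ≡ subᵗ ξ A
subᵗ-subᵗ θ η ξ e (A ⊗ B)  = cong₂ _⊗_ (subᵗ-subᵗ θ η ξ e A) (subᵗ-subᵗ θ η ξ e B)
subᵗ-subᵗ θ η ξ e (A ⅋ B)  = cong₂ _⅋_ (subᵗ-subᵗ θ η ξ e A) (subᵗ-subᵗ θ η ξ e B)
subᵗ-subᵗ θ η ξ e (A ⊕ B)  = cong₂ _⊕_ (subᵗ-subᵗ θ η ξ e A) (subᵗ-subᵗ θ η ξ e B)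
subᵗ-subᵗ θ η ξ e (A & B)  = cong₂ _&_ (subᵗ-subᵗ θ η ξ e A) (subᵗ-subᵗ θ η ξ e B)
subᵗ-subᵗ θ η ξ e 𝟏        = refl
subᵗ-subᵗ θ η ξ e ⊥ᵗ       = refl
subᵗ-subᵗ θ η ξ e (var X)  = e X
subᵗ-subᵗ θ η ξ e (var⊥ X) = trans (subᵗ-^⊥ θ (η X)) (cong _^⊥ (e X))
subᵗ-subᵗ θ η ξ e (∃ᵗ A)   = cong ∃ᵗ_ (subᵗ-subᵗ (lift θ) (lift η) (lift ξ) (subᵗ-lift θ η ξ e) A)
subᵗ-subᵗ θ η ξ e (∀ᵗ A)   = cong ∀ᵗ_ (subᵗ-subᵗ (lift θ) (lift η) (lift ξ) (subᵗ-lift θ η ξ e) A)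
subᵗ-subᵗ θ η ξ e (⁇ A)    = cong ⁇_ (subᵗ-subᵗ θ η ξ e A)
subᵗ-subᵗ θ η ξ e (! A)    = cong !_ (subᵗ-subᵗ θ η ξ e A)

single-renᵗ-suc : ∀ A B → renᵗ suc B [ A ]ᵗ ≡ B
single-renᵗ-suc A B =
  trans (subᵗ-renᵗ suc (single A) var (λ _ → refl) B) (subᵗ-var var (λ _ → refl) B)

-- Both sides collapse to the single substitution `ξ`. This is what makes `∃-I` stable under type
-- substitution.
subᵗ-[]ᵗ : ∀ θ B A → subᵗ θ (B [ A ]ᵗ) ≡ subᵗ (lift θ) B [ subᵗ θ A ]ᵗ
subᵗ-[]ᵗ θ B A = trans (subᵗ-subᵗ θ (single A) ξ (λ _ → refl) B)
                       (sym (subᵗ-subᵗ (single (subᵗ θ A)) (lift θ) ξ pointwise B))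
  where
  ξ = subᵗ θ ∘ single A
  pointwise : ∀ X → lift θ X [ subᵗ θ A ]ᵗ ≡ ξ X
  pointwise zero    = refl
  pointwise (suc X) = single-renᵗ-suc _ (θ X)

module _ (𝒩 : Names) where

  open Names 𝒩
  open πLL 𝒩
  open DecMembership _≟_ using (_∈?_)

  -- Hyperenvironments up to exchange, and the names occurring in them

  module ≋  = Setoid↭ (↭-setoid {A = Name × Type})
  module ≋ₚ = Setoid↭ₚ (↭-setoid {A = Name × Type})

  single-≋ : ∀ {Γ Δ 𝒢} → Γ ↭ Δ → Γ ∷ 𝒢 ≋ Δ ∷ 𝒢
  single-≋ r = Homogeneous.prep r ≋.↭-refl

  prep-≋ : ∀ {Γ 𝒢 ℋ} → 𝒢 ≋ ℋ → Γ ∷ 𝒢 ≋ Γ ∷ ℋ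
  prep-≋ = Homogeneous.prep ↭-refl

  swap-≋ : ∀ {Γ Δ 𝒢} → Γ ∷ Δ ∷ 𝒢 ≋ Δ ∷ Γ ∷ 𝒢
  swap-≋ = Homogeneous.swap ↭-refl ↭-refl ≋.↭-refl

  concat-≋ : ∀ {𝒢 ℋ} → 𝒢 ≋ ℋ → concat 𝒢 ↭ concat ℋ
  concat-≋ (Homogeneous.refl e)       = pointwise e
    where
    pointwise : ∀ {𝒢 ℋ} → Pointwise _↭_ 𝒢 ℋ → concat 𝒢 ↭ concat ℋ
    pointwise []      = ↭-refl
    pointwise (p ∷ e) = ↭.++⁺ p (pointwise e)
  concat-≋ (Homogeneous.prep p e)     = ↭.++⁺ p (concat-≋ e)
  concat-≋ (Homogeneous.swap {x = Γ} {Δ} p q e) =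
    ↭-trans (↭.shifts Γ Δ) (↭.++⁺ q (↭.++⁺ p (concat-≋ e)))
  concat-≋ (Homogeneous.trans e f)    = ↭-trans (concat-≋ e) (concat-≋ f)

  names-≋ : ∀ {𝒢 ℋ} → 𝒢 ≋ ℋ → names 𝒢 ↭ names ℋ
  names-≋ = ↭.map⁺ proj₁ ∘ concat-≋

  Unique-resp-↭ : ∀ {xs ys : List Name} → xs ↭ ys → Unique xs → Unique ys
  Unique-resp-↭ p = Setoid↭ₚ.Unique-resp-↭ (setoid Name) (↭⇒↭ₛ p)

  infix 4 _∈ʰ_

  -- Nested occurrence rather than membership in `names 𝒢`: matching on it reveals the environment
  -- that holds the name, which the cases of `cut` and `⊗-I` have to distinguish.
  _∈ʰ_ : Name → HEnv → Set
  z ∈ʰ 𝒢 = Any (λ Γ → z ∈ dom Γ) 𝒢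

  ∈ʰ-resp-≋ : ∀ {z 𝒢 ℋ} → 𝒢 ≋ ℋ → z ∈ʰ 𝒢 → z ∈ʰ ℋ
  ∈ʰ-resp-≋ = ≋ₚ.Any-resp-↭ (↭.∈-resp-↭ ∘ ↭.map⁺ proj₁)

  ∈ʰ⇒∈names : ∀ {z 𝒢} → z ∈ʰ 𝒢 → z ∈ names 𝒢
  ∈ʰ⇒∈names = Any.map⁺ ∘ Any.concat⁺ ∘ Any.map Any.map⁻

  ∈names⇒∈ʰ : ∀ {z} 𝒢 → z ∈ names 𝒢 → z ∈ʰ 𝒢
  ∈names⇒∈ʰ 𝒢 = Any.map Any.map⁺ ∘ Any.concat⁻ 𝒢 ∘ Any.map⁻

  ∈ʰ-[_] : ∀ {z Γ} → z ∈ʰ [ Γ ] → z ∈ dom Γ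
  ∈ʰ-[ here p ] = p

  ∈ʰ-∷ : ∀ {z e Γ 𝒢} → z ∈ʰ Γ ∷ 𝒢 → z ∈ʰ (e ∷ Γ) ∷ 𝒢
  ∈ʰ-∷ (here p)  = here (there p)
  ∈ʰ-∷ (there p) = there p

  dom-++⁻ : ∀ {z} Γ {Δ} → z ∈ dom (Γ ++ Δ) → z ∈ dom Γ ⊎ z ∈ dom Δ
  dom-++⁻ Γ {Δ} p = ∈-++⁻ (dom Γ) (subst (_ ∈_) (map-++ proj₁ Γ Δ) p)

  dom-++⁺ˡ : ∀ {z Γ} Δ → z ∈ dom Γ → z ∈ dom (Γ ++ Δ)
  dom-++⁺ˡ {z} {Γ} Δ p = subst (z ∈_) (sym (map-++ proj₁ Γ Δ)) (∈-++⁺ˡ p)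

  dom-++⁺ʳ : ∀ {z} Γ {Δ} → z ∈ dom Δ → z ∈ dom (Γ ++ Δ)
  dom-++⁺ʳ {z} Γ {Δ} p = subst (z ∈_) (sym (map-++ proj₁ Γ Δ)) (∈-++⁺ʳ (dom Γ) p)

  dom-weaken : ∀ Γ → dom (weaken Γ) ≡ dom Γ
  dom-weaken Γ = sym (map-∘ Γ)

  ∖⁻ : ∀ {z y xs} → z ∈ xs ∖ y → z ∈ xs × z ≢ y
  ∖⁻ {y = y} {xs} = ∈-filter⁻ (λ z → ¬? (z ≟ y)) {xs = xs}

  ∖⁺ : ∀ {z y xs} → z ∈ xs → z ≢ y → z ∈ xs ∖ y
  ∖⁺ {y = y} = ∈-filter⁺ (λ z → ¬? (z ≟ y))

  join-↭ : ∀ {e f : Name × Type} Γ {Δ 𝒢} →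
           concat ((e ∷ Γ) ∷ (f ∷ Δ) ∷ 𝒢) ↭ e ∷ f ∷ concat ((Γ ++ Δ) ∷ 𝒢)
  join-↭ {e} {f} Γ {Δ} {𝒢} = prep e (↭-trans (↭.shift f Γ (Δ ++ concat 𝒢))
                                       (prep f (↭-reflexive (sym (++-assoc Γ Δ (concat 𝒢))))))

  Unique-∷ : ∀ {x} Γ → x ∉ dom Γ → Unique (names [ Γ ]) → Unique (x ∷ names [ Γ ])
  Unique-∷ {x} Γ x∉Γ u = All.¬Any⇒All¬ _ (λ p → x∉Γ (∈ʰ-[ ∈names⇒∈ʰ [ Γ ] p ])) ∷ u

  tail-unique : ∀ {x : Name} {xs} → Unique (x ∷ xs) → Unique xs
  tail-unique (_ ∷ u) = u

  -- Distinctness of names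

  typed-unique : ∀ {P 𝒢} → ⊢ P ⦂ 𝒢 → Unique (names 𝒢)
  typed-unique (exch e d)       = Unique-resp-↭ (names-≋ e) (typed-unique d)
  typed-unique (ax x≢y)         = (x≢y ∷ []) ∷ [] ∷ []
  typed-unique (cut {𝒢 = 𝒢} {Γ} {Δ} {x} {y} {A} d)
    with Unique-resp-↭ (↭.map⁺ proj₁ (join-↭ {x , A} {y , A ^⊥} Γ {Δ} {𝒢})) (typed-unique d)
  ... | _ ∷ _ ∷ u = u
  typed-unique (mix {𝒢 = 𝒢} {ℋ} 𝒢#ℋ d e) =
    subst Unique (sym (trans (cong dom (sym (concat-++ 𝒢 ℋ))) (map-++ proj₁ (concat 𝒢) (concat ℋ))))
      (Unique.++⁺ (typed-unique d) (typed-unique e) 𝒢#ℋ)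
  typed-unique mix₀             = []
  typed-unique (⊗-I {Γ = Γ} {Δ} {x} {y} {A} {B} d) =
    tail-unique (Unique-resp-↭ (↭.map⁺ proj₁ (join-↭ {y , A} {x , B} Γ {Δ} {[]})) (typed-unique d))
  typed-unique (1-I d)          = [] ∷ []
  typed-unique (⅋-I d)          = tail-unique (typed-unique d)
  typed-unique (⊥-I {Γ = Γ} x∉ d) = Unique-∷ Γ x∉ (typed-unique d)
  typed-unique (⊕-I₁ d)         = typed-unique d
  typed-unique (⊕-I₂ d)         = typed-unique d
  typed-unique (&-I d e)        = typed-unique d
  typed-unique (!-I {Γ = Γ} _ x∉ d) = Unique-∷ Γ x∉ (tail-unique (typed-unique d))
  typed-unique (?-I {Γ = Γ} x∉ d) = Unique-∷ Γ x∉ (tail-unique (typed-unique d))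
  typed-unique (W {Γ = Γ} x∉ d) = Unique-∷ Γ x∉ (typed-unique d)
  typed-unique (C {Γ = Γ} x∉ d) = Unique-∷ Γ x∉ (tail-unique (tail-unique (typed-unique d)))
  typed-unique (∃-I d)          = typed-unique d
  typed-unique (∀-I {Γ = Γ} {x} d) = subst (λ xs → Unique (x ∷ xs)) eq (typed-unique d)
    where
    eq : names [ weaken Γ ] ≡ names [ Γ ]
    eq = trans (cong dom (++-identityʳ (weaken Γ)))
               (trans (dom-weaken Γ) (cong dom (sym (++-identityʳ Γ))))

  head-fresh : ∀ {P x A Γ 𝒢 z} → ⊢ P ⦂ ((x , A) ∷ Γ) ∷ 𝒢 → z ∈ʰ Γ ∷ 𝒢 → z ≢ x
  head-fresh d p refl = Unique.Unique[x∷xs]⇒x∉xs (typed-unique d) (∈ʰ⇒∈names p)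

  fn⊆names : ∀ {P 𝒢 z} → ⊢ P ⦂ 𝒢 → z ∈ fn P → z ∈ʰ 𝒢
  fn⊆names (exch e d) p = ∈ʰ-resp-≋ e (fn⊆names d p)
  fn⊆names (ax _) (here e) = here (here e)
  fn⊆names (ax _) (there (here e)) = here (there (here e))
  fn⊆names (cut {Γ = Γ} d) p with ∖⁻ p
  ... | p′ , z≢y with ∖⁻ p′
  ... | p″ , z≢x with fn⊆names d p″
  ... | here (here e)          = contradiction e z≢x
  ... | here (there q)         = here (dom-++⁺ˡ _ q)
  ... | there (here (here e))  = contradiction e z≢y
  ... | there (here (there q)) = here (dom-++⁺ʳ Γ q)
  ... | there (there q)        = there q
  fn⊆names {P ∥ Q} (mix {𝒢 = 𝒢} _ d e) p with ∈-++⁻ (fn P) p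
  ... | inj₁ q = Any.++⁺ˡ (fn⊆names d q)
  ... | inj₂ q = Any.++⁺ʳ 𝒢 (fn⊆names e q)
  fn⊆names (⊗-I d) (here e) = here (here e)
  fn⊆names (⊗-I {Γ = Γ} d) (there p) with ∖⁻ p
  ... | p′ , z≢y with fn⊆names d p′
  ... | here (here e)          = contradiction e z≢y
  ... | here (there q)         = here (there (dom-++⁺ˡ _ q))
  ... | there (here (here e))  = here (here e)
  ... | there (here (there q)) = here (there (dom-++⁺ʳ Γ q))
  fn⊆names (1-I d) (here e) = here (here e)
  fn⊆names (1-I d) (there p) = contradiction (fn⊆names d p) λ ()
  fn⊆names (⅋-I d) (here e) = here (here e)
  fn⊆names (⅋-I d) (there p) with ∖⁻ p
  ... | p′ , z≢y with fn⊆names d p′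
  ... | here (here e)          = contradiction e z≢y
  ... | here (there q)         = here q
  fn⊆names (⊥-I x∉ d) (here e) = here (here e)
  fn⊆names (⊥-I x∉ d) (there p) = here (there ∈ʰ-[ fn⊆names d p ])
  fn⊆names (⊕-I₁ d) (here e) = here (here e)
  fn⊆names (⊕-I₁ d) (there p) = here ∈ʰ-[ fn⊆names d p ]
  fn⊆names (⊕-I₂ d) (here e) = here (here e)
  fn⊆names (⊕-I₂ d) (there p) = here ∈ʰ-[ fn⊆names d p ]
  fn⊆names (&-I d e) (here eq) = here (here eq)
  fn⊆names {x ▹⦅ P ∣ Q ⦆} (&-I d e) (there p) with ∈-++⁻ (fn P) p
  ... | inj₁ q = here ∈ʰ-[ fn⊆names d q ]
  ... | inj₂ q = here ∈ʰ-[ fn⊆names e q ]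
  fn⊆names (!-I _ _ d) (here e) = here (here e)
  fn⊆names (!-I _ _ d) (there p) with ∖⁻ p
  ... | p′ , z≢y with fn⊆names d p′
  ... | here (here e)          = contradiction e z≢y
  ... | here (there q)         = here (there q)
  fn⊆names (?-I _ d) (here e) = here (here e)
  fn⊆names (?-I _ d) (there p) with ∖⁻ p
  ... | p′ , z≢y with fn⊆names d p′
  ... | here (here e)          = contradiction e z≢y
  ... | here (there q)         = here (there q)
  fn⊆names (W x∉ d) (here e) = here (here e)
  fn⊆names (W x∉ d) (there p) = here (there ∈ʰ-[ fn⊆names d p ])
  fn⊆names (C _ d) (here e) = here (here e)
  fn⊆names (C _ d) (there p) with ∖⁻ p
  ... | p′ , z≢y with ∖⁻ p′
  ... | p″ , z≢x with fn⊆names d p″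
  ... | here (here e)          = contradiction e z≢x
  ... | here (there (here e))  = contradiction e z≢y
  ... | here (there (there q)) = here (there q)
  fn⊆names (∃-I d) (here e) = here (here e)
  fn⊆names (∃-I d) (there p) = here ∈ʰ-[ fn⊆names d p ]
  fn⊆names (∀-I d) (here e) = here (here e)
  fn⊆names (∀-I {Γ = Γ} {x} d) (there p) =
    here (subst (λ xs → _ ∈ x ∷ xs) (dom-weaken Γ) ∈ʰ-[ fn⊆names d p ])

  -- Weakening leaves a trace in the process: every name that a rule adds to an environment is the
  -- subject of the prefix. With `fn⊆names`, a typing thus mentions exactly the free names, so side
  -- conditions on `fn` and conditions on hyperenvironments are interchangeable.
  names⊆fn : ∀ {P 𝒢 z} → ⊢ P ⦂ 𝒢 → z ∈ʰ 𝒢 → z ∈ fn P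
  names⊆fn (exch e d) p = names⊆fn d (∈ʰ-resp-≋ (≋.↭-sym e) p)
  names⊆fn (ax _) (here (here e)) = here e
  names⊆fn (ax _) (here (there (here e))) = there (here e)
  names⊆fn (cut {𝒢 = 𝒢} {Γ} {Δ} {x} {y} {A} d) p =
    ∖⁺ (∖⁺ (names⊆fn d (rest p)) (head-fresh d (tail p)))
       (head-fresh (exch swap-≋ d) (swapped p))
    where
    tail : ∀ {z} → z ∈ʰ (Γ ++ Δ) ∷ 𝒢 → z ∈ʰ Γ ∷ ((y , A ^⊥) ∷ Δ) ∷ 𝒢
    tail (here q) with dom-++⁻ Γ q
    ... | inj₁ r = here r
    ... | inj₂ r = there (here (there r))
    tail (there q) = there (there q)
    rest : ∀ {z} → z ∈ʰ (Γ ++ Δ) ∷ 𝒢 → z ∈ʰ ((x , A) ∷ Γ) ∷ ((y , A ^⊥) ∷ Δ) ∷ 𝒢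
    rest q with tail q
    ... | here r  = here (there r)
    ... | there r = there r
    swapped : ∀ {z} → z ∈ʰ (Γ ++ Δ) ∷ 𝒢 → z ∈ʰ Δ ∷ ((x , A) ∷ Γ) ∷ 𝒢
    swapped (here q) with dom-++⁻ Γ q
    ... | inj₁ r = there (here (there r))
    ... | inj₂ r = here r
    swapped (there q) = there (there q)
  names⊆fn {P ∥ Q} (mix {𝒢 = 𝒢} _ d e) p with Any.++⁻ 𝒢 p
  ... | inj₁ q = ∈-++⁺ˡ (names⊆fn d q)
  ... | inj₂ q = ∈-++⁺ʳ (fn P) (names⊆fn e q)
  names⊆fn (⊗-I d) (here (here e)) = here e
  names⊆fn {x ⟦ y ⟧· P} (⊗-I {Γ = Γ} d) (here (there p)) with dom-++⁻ Γ p
  ... | inj₁ q = there (∖⁺ (names⊆fn d (here (there q))) (head-fresh d (here q)))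
  ... | inj₂ q = there (∖⁺ (names⊆fn d (there (here (there q))))
                       (head-fresh d (there (here (there q)))))
  names⊆fn (1-I d) (here (here e)) = here e
  names⊆fn (⅋-I d) (here p) = there (∖⁺ (names⊆fn d (here (there p))) (head-fresh d (here p)))
  names⊆fn (⊥-I _ d) (here (here e)) = here e
  names⊆fn (⊥-I _ d) (here (there p)) = there (names⊆fn d (here p))
  names⊆fn (⊕-I₁ d) (here p) = there (names⊆fn d (here p))
  names⊆fn (⊕-I₂ d) (here p) = there (names⊆fn d (here p))
  names⊆fn (&-I d _) (here p) = there (∈-++⁺ˡ (names⊆fn d (here p)))
  names⊆fn (!-I _ _ d) (here (here e)) = here e
  names⊆fn (!-I _ _ d) (here (there p)) =
    there (∖⁺ (names⊆fn d (here (there p))) (head-fresh d (here p)))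
  names⊆fn (?-I _ d) (here (here e)) = here e
  names⊆fn (?-I _ d) (here (there p)) =
    there (∖⁺ (names⊆fn d (here (there p))) (head-fresh d (here p)))
  names⊆fn (W _ d) (here (here e)) = here e
  names⊆fn (W _ d) (here (there p)) = there (names⊆fn d (here p))
  names⊆fn (C _ d) (here (here e)) = here e
  names⊆fn (C {Γ = Γ} {x₁ = x₁} {x₂} {A} _ d) (here (there p)) =
    there (∖⁺ (∖⁺ (names⊆fn d (here (there (there p)))) (head-fresh d (here (there p))))
              (head-fresh (exch (single-≋ (_↭_.swap (x₁ , ⁇ A) (x₂ , ⁇ A) ↭-refl)) d)
                          (here (there p))))
  names⊆fn (∃-I d) (here p) = there (names⊆fn d (here p))
  names⊆fn (∀-I {Γ = Γ} {x} d) (here p) =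
    there (names⊆fn d (here (subst (λ xs → _ ∈ x ∷ xs) (sym (dom-weaken Γ)) p)))

  -- Renaming and substitution

  cast : ∀ {P 𝒢 ℋ} → 𝒢 ≡ ℋ → ⊢ P ⦂ 𝒢 → ⊢ P ⦂ ℋ
  cast refl d = d

  renameᵉ : (Name → Name) → Env → Env
  renameᵉ σ = map (map₁ σ)

  renameʰ : (Name → Name) → HEnv → HEnv
  renameʰ σ = map (renameᵉ σ)

  renameʰ-≋ : ∀ {𝒢 ℋ} σ → 𝒢 ≋ ℋ → renameʰ σ 𝒢 ≋ renameʰ σ ℋ
  renameʰ-≋ σ = ≋ₚ.map⁺ ↭-setoid (↭.map⁺ (map₁ σ))

  renameᵉ-cong : ∀ {σ τ} Γ → (∀ {z} → z ∈ dom Γ → σ z ≡ τ z) → renameᵉ σ Γ ≡ renameᵉ τ Γ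
  renameᵉ-cong []            e = refl
  renameᵉ-cong ((x , A) ∷ Γ) e =
    cong₂ (λ y Δ → (y , A) ∷ Δ) (e (here refl)) (renameᵉ-cong Γ (e ∘ there))

  renameʰ-cong : ∀ {σ τ} 𝒢 → (∀ {z} → z ∈ʰ 𝒢 → σ z ≡ τ z) → renameʰ σ 𝒢 ≡ renameʰ τ 𝒢
  renameʰ-cong []      e = refl
  renameʰ-cong (Γ ∷ 𝒢) e = cong₂ _∷_ (renameᵉ-cong Γ (e ∘ here)) (renameʰ-cong 𝒢 (e ∘ there))

  renameᵉ-id : ∀ Γ → renameᵉ (λ x → x) Γ ≡ Γ
  renameᵉ-id = map-id

  renameʰ-id : ∀ 𝒢 → renameʰ (λ x → x) 𝒢 ≡ 𝒢
  renameʰ-id 𝒢 = trans (map-cong renameᵉ-id 𝒢) (map-id 𝒢)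

  ∈-dom-rename⁻ : ∀ {z} σ Γ → z ∈ dom (renameᵉ σ Γ) → ∃ λ w → w ∈ dom Γ × z ≡ σ w
  ∈-dom-rename⁻ σ Γ p = ∈-map⁻ σ (subst (_ ∈_) (trans (sym (map-∘ Γ)) (map-∘ Γ)) p)

  ∈ʰ-rename⁻ : ∀ {z} σ 𝒢 → z ∈ʰ renameʰ σ 𝒢 → ∃ λ w → w ∈ʰ 𝒢 × z ≡ σ w
  ∈ʰ-rename⁻ σ (Γ ∷ 𝒢) (here p)  = map₂ (map₁ here) (∈-dom-rename⁻ σ Γ p)
  ∈ʰ-rename⁻ σ (Γ ∷ 𝒢) (there p) = map₂ (map₁ there) (∈ʰ-rename⁻ σ 𝒢 p)

  ∈ʰ-rename⁺ : ∀ {z 𝒢} σ → z ∈ʰ 𝒢 → σ z ∈ʰ renameʰ σ 𝒢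
  ∈ʰ-rename⁺ {𝒢 = Γ ∷ 𝒢} σ (here p)  =
    here (subst (_ ∈_) (trans (sym (map-∘ Γ)) (map-∘ Γ)) (∈-map⁺ σ p))
  ∈ʰ-rename⁺ σ (there p) = there (∈ʰ-rename⁺ σ p)

  rename-weaken : ∀ σ Γ → renameᵉ σ (weaken Γ) ≡ weaken (renameᵉ σ Γ)
  rename-weaken σ Γ = trans (sym (map-∘ Γ)) (map-∘ Γ)

  rename-AllWhyNot : ∀ {Γ} σ → AllWhyNot Γ → AllWhyNot (renameᵉ σ Γ)
  rename-AllWhyNot σ = All.map⁺

  rename-∉ : ∀ {σ x xs} Γ → InjectiveOn xs σ → x ∈ xs → (∀ {z} → z ∈ dom Γ → z ∈ xs) →
             x ∉ dom Γ → σ x ∉ dom (renameᵉ σ Γ)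
  rename-∉ {σ} Γ inj x∈ Γ⊆ x∉ p with ∈-dom-rename⁻ σ Γ p
  ... | w , q , eq = x∉ (subst (_∈ dom Γ) (sym (inj x∈ (Γ⊆ q) eq)) q)

  rename-disjoint : ∀ {σ} xs 𝒢 ℋ → InjectiveOn xs σ → (∀ {z} → z ∈ʰ 𝒢 → z ∈ xs) →
                    (∀ {z} → z ∈ʰ ℋ → z ∈ xs) → Disjoint (names 𝒢) (names ℋ) →
                    Disjoint (names (renameʰ σ 𝒢)) (names (renameʰ σ ℋ))
  rename-disjoint {σ} xs 𝒢 ℋ inj 𝒢⊆ ℋ⊆ 𝒢#ℋ (p , q)
    with ∈ʰ-rename⁻ σ 𝒢 (∈names⇒∈ʰ (renameʰ σ 𝒢) p) | ∈ʰ-rename⁻ σ ℋ (∈names⇒∈ʰ (renameʰ σ ℋ) q)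
  ... | v , p′ , refl | w , q′ , eq =
    𝒢#ℋ (∈ʰ⇒∈names p′ , ∈ʰ⇒∈names (subst (_∈ʰ ℋ) (sym (inj (𝒢⊆ p′) (ℋ⊆ q′) eq)) q′))

  module _ {s : Name → Name} (inj : ∀ {x y} → s x ≡ s y → x ≡ y) where

    private
      s-∉ : ∀ {x} Γ → x ∉ dom Γ → s x ∉ dom (renameᵉ s Γ)
      s-∉ {x} Γ = rename-∉ {xs = x ∷ dom Γ} Γ (λ _ _ → inj) (here refl) there

    -- `replace` acts on binders too, hence injectivity everywhere rather than on free names; in
    -- return each rule is mapped to itself and no fresh names are chosen.
    replace-typed : ∀ {P 𝒢} → ⊢ P ⦂ 𝒢 → ⊢ replace s P ⦂ renameʰ s 𝒢
    replace-typed (exch e d)   = exch (renameʰ-≋ s e) (replace-typed d)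
    replace-typed (ax x≢y)     = ax (x≢y ∘ inj)
    replace-typed (cut {Γ = Γ} {Δ} d) =
      cast (cong (_∷ _) (sym (map-++ _ Γ Δ))) (cut (replace-typed d))
    replace-typed (mix {𝒢 = 𝒢} {ℋ} 𝒢#ℋ d e) =
      cast (sym (map-++ _ 𝒢 ℋ))
        (mix (rename-disjoint (names 𝒢 ++ names ℋ) 𝒢 ℋ (λ _ _ → inj)
               (∈-++⁺ˡ ∘ ∈ʰ⇒∈names) (∈-++⁺ʳ (names 𝒢) ∘ ∈ʰ⇒∈names) 𝒢#ℋ)
             (replace-typed d) (replace-typed e))
    replace-typed mix₀         = mix₀
    replace-typed (⊗-I {Γ = Γ} {Δ} d) =
      cast (cong (λ Θ → [ _ ∷ Θ ]) (sym (map-++ _ Γ Δ))) (⊗-I (replace-typed d))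
    replace-typed (1-I d)      = 1-I (replace-typed d)
    replace-typed (⅋-I d)      = ⅋-I (replace-typed d)
    replace-typed (⊥-I x∉ d)   = ⊥-I (s-∉ _ x∉) (replace-typed d)
    replace-typed (⊕-I₁ d)     = ⊕-I₁ (replace-typed d)
    replace-typed (⊕-I₂ d)     = ⊕-I₂ (replace-typed d)
    replace-typed (&-I d e)    = &-I (replace-typed d) (replace-typed e)
    replace-typed (!-I ⁇Γ x∉ d) = !-I (rename-AllWhyNot s ⁇Γ) (s-∉ _ x∉) (replace-typed d)
    replace-typed (?-I x∉ d)   = ?-I (s-∉ _ x∉) (replace-typed d)
    replace-typed (W x∉ d)     = W (s-∉ _ x∉) (replace-typed d)
    replace-typed (C x∉ d)     = C (s-∉ _ x∉) (replace-typed d)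
    replace-typed (∃-I d)      = ∃-I (replace-typed d)
    replace-typed (∀-I {Γ = Γ} d) =
      ∀-I (cast (cong (λ Θ → [ _ ∷ Θ ]) (rename-weaken s Γ)) (replace-typed d))

  update-≡ : ∀ σ y y′ → (σ [ y ↦ y′ ]) y ≡ y′
  update-≡ σ y y′ with y ≟ y
  ... | yes _  = refl
  ... | no y≢y = contradiction refl y≢y

  update-≢ : ∀ σ y y′ {z} → z ≢ y → (σ [ y ↦ y′ ]) z ≡ σ z
  update-≢ σ y y′ {z} z≢y with z ≟ y
  ... | yes z≡y = contradiction z≡y z≢y
  ... | no _    = refl

  update-injective : ∀ {σ y y′} xs → InjectiveOn (xs ∖ y) σ → y′ ∉ map σ (xs ∖ y) →
                     InjectiveOn xs (σ [ y ↦ y′ ])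
  update-injective {σ} {y} xs inj y′∉ {a} {b} a∈ b∈ e with a ≟ y | b ≟ y
  ... | yes refl | yes refl = refl
  ... | yes refl | no b≢y   =
    contradiction (subst (_∈ _) (sym e) (∈-map⁺ σ (∖⁺ b∈ b≢y))) y′∉
  ... | no a≢y   | yes refl =
    contradiction (subst (_∈ _) e (∈-map⁺ σ (∖⁺ a∈ a≢y))) y′∉
  ... | no a≢y   | no b≢y   = inj (∖⁺ a∈ a≢y) (∖⁺ b∈ b≢y) e

  pick-∉ : ∀ y xs → pick y xs ∉ xs
  pick-∉ y xs with y ∈? xs
  ... | yes _ = proj₂ (fresh xs)
  ... | no y∉ = y∉

  update-fresh : ∀ {σ x x′ w} xs → w ∉ x′ ∷ map σ (xs ∖ x) → w ∉ map (σ [ x ↦ x′ ]) xs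
  update-fresh {σ} {x} {x′} xs w∉ p with ∈-map⁻ _ p
  ... | a , a∈ , e with a ≟ x
  ... | yes refl = w∉ (here e)
  ... | no a≢x   = w∉ (there (subst (_∈ _) (sym e) (∈-map⁺ σ (∖⁺ a∈ a≢x))))

  update₂-injective : ∀ {σ x y x′ y′} xs → InjectiveOn (xs ∖ x ∖ y) σ →
                      x′ ∉ map σ (xs ∖ x ∖ y) → y′ ∉ x′ ∷ map σ (xs ∖ x ∖ y) →
                      InjectiveOn xs (σ [ x ↦ x′ ] [ y ↦ y′ ])
  update₂-injective {σ} {x} {y} xs inj x′∉ y′∉ =
    update-injective xs
      (update-injective (xs ∖ y) (λ a b → inj (∖-comm a) (∖-comm b)) (x′∉ ∘ map-comm))
      (update-fresh (xs ∖ y) λ { (here e) → y′∉ (here e) ; (there p) → y′∉ (there (map-comm p)) })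
    where
    -- The outer update is the one at `y`, so `update-injective` removes `y` before `x`, whereas
    -- `fn` of a double binder removes `x` first.
    ∖-comm : ∀ {z} → z ∈ xs ∖ y ∖ x → z ∈ xs ∖ x ∖ y
    ∖-comm p = let q , z≢x = ∖⁻ {xs = xs ∖ y} p ; r , z≢y = ∖⁻ {xs = xs} q in ∖⁺ (∖⁺ r z≢x) z≢y
    map-comm : ∀ {z} → z ∈ map σ (xs ∖ y ∖ x) → z ∈ map σ (xs ∖ x ∖ y)
    map-comm p = let a , a∈ , e = ∈-map⁻ σ p in subst (_∈ _) (sym e) (∈-map⁺ σ (∖-comm a∈))

  update₂-≡ : ∀ σ x x′ y y′ → x ≢ y → (σ [ x ↦ x′ ] [ y ↦ y′ ]) x ≡ x′
  update₂-≡ σ x x′ y y′ x≢y = trans (update-≢ _ y y′ x≢y) (update-≡ σ x x′)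

  update₂-≢ : ∀ σ x x′ y y′ {z} → z ≢ x → z ≢ y → (σ [ x ↦ x′ ] [ y ↦ y′ ]) z ≡ σ z
  update₂-≢ σ x x′ y y′ z≢x z≢y = trans (update-≢ _ y y′ z≢y) (update-≢ σ x x′ z≢x)

  rename-update : ∀ {P y A Γ 𝒢} σ y′ → ⊢ P ⦂ ((y , A) ∷ Γ) ∷ 𝒢 →
                  renameʰ (σ [ y ↦ y′ ]) (((y , A) ∷ Γ) ∷ 𝒢) ≡
                  ((y′ , A) ∷ renameᵉ σ Γ) ∷ renameʰ σ 𝒢
  rename-update {y = y} {A} {Γ} {𝒢} σ y′ d =
    cong₂ _∷_ (cong₂ (λ z Θ → (z , A) ∷ Θ) (update-≡ σ y y′) (renameᵉ-cong Γ (agree ∘ here)))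
              (renameʰ-cong 𝒢 (agree ∘ there))
    where
    agree : ∀ {z} → z ∈ʰ Γ ∷ 𝒢 → (σ [ y ↦ y′ ]) z ≡ σ z
    agree p = update-≢ σ y y′ (head-fresh d p)

  -- Identifying two free names would break the distinctness of names, hence injectivity on `fn P`.
  -- It passes below binders because `pick` avoids the images of the remaining free names, and it
  -- covers all of `𝒢` by `names⊆fn`.
  sub-typed : ∀ {P 𝒢} σ → InjectiveOn (fn P) σ → ⊢ P ⦂ 𝒢 → ⊢ sub σ P ⦂ renameʰ σ 𝒢
  sub-typed σ inj (exch e d) = exch (renameʰ-≋ σ e) (sub-typed σ inj d)
  sub-typed σ inj (ax x≢y) = ax (x≢y ∘ inj (here refl) (there (here refl)))
  sub-typed {⦅ν x ∣ y ⦆ P} σ inj (cut {𝒢 = 𝒢} {Γ} {Δ} {A = A} d) =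
    cast (cong (_∷ _) (sym (map-++ _ Γ Δ)))
      (cut (cast eq (sub-typed σ′ (update₂-injective (fn P) inj x′∉ y′∉) d)))
    where
    x′ = pick x (map σ (fn P ∖ x ∖ y))
    y′ = pick y (x′ ∷ map σ (fn P ∖ x ∖ y))
    x′∉ = pick-∉ x (map σ (fn P ∖ x ∖ y))
    y′∉ = pick-∉ y (x′ ∷ map σ (fn P ∖ x ∖ y))
    σ′ = σ [ x ↦ x′ ] [ y ↦ y′ ]
    -- `head-fresh` concerns only the first name of the first environment; exchange puts `y` there.
    d′ : ⊢ P ⦂ ((y , A ^⊥) ∷ Δ) ∷ ((x , A) ∷ Γ) ∷ 𝒢
    d′ = exch swap-≋ d
    agree : ∀ {z} → z ∈ʰ Γ ∷ ((y , A ^⊥) ∷ Δ) ∷ 𝒢 → z ∈ʰ Δ ∷ ((x , A) ∷ Γ) ∷ 𝒢 → σ′ z ≡ σ z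
    agree p q = update₂-≢ σ x x′ y y′ (head-fresh d p) (head-fresh d′ q)
    eq : renameʰ σ′ (((x , A) ∷ Γ) ∷ ((y , A ^⊥) ∷ Δ) ∷ 𝒢) ≡
         ((x′ , A) ∷ renameᵉ σ Γ) ∷ ((y′ , A ^⊥) ∷ renameᵉ σ Δ) ∷ renameʰ σ 𝒢
    eq = cong₂ _∷_
           (cong₂ (λ z Θ → (z , A) ∷ Θ)
                  (update₂-≡ σ x x′ y y′ (head-fresh d′ (there (here (here refl)))))
                  (renameᵉ-cong Γ λ p → agree (here p) (there (here (there p)))))
           (cong₂ _∷_
             (cong₂ (λ z Θ → (z , A ^⊥) ∷ Θ) (update-≡ _ y y′)
                    (renameᵉ-cong Δ λ p → agree (there (here (there p))) (here p)))
             (renameʰ-cong 𝒢 λ p → agree (there (there p)) (there (there p))))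
  sub-typed {P ∥ Q} σ inj (mix {𝒢 = 𝒢} {ℋ} 𝒢#ℋ d e) =
    cast (sym (map-++ _ 𝒢 ℋ))
      (mix (rename-disjoint (fn P ++ fn Q) 𝒢 ℋ inj
             (∈-++⁺ˡ ∘ names⊆fn d) (∈-++⁺ʳ (fn P) ∘ names⊆fn e) 𝒢#ℋ)
           (sub-typed σ (λ a b → inj (∈-++⁺ˡ a) (∈-++⁺ˡ b)) d)
           (sub-typed σ (λ a b → inj (∈-++⁺ʳ (fn P) a) (∈-++⁺ʳ (fn P) b)) e))
  sub-typed σ inj mix₀ = mix₀
  sub-typed {x ⟦ y ⟧· P} σ inj (⊗-I {Γ = Γ} {Δ} d) =
    cast (cong (λ Θ → [ _ ∷ Θ ]) (sym (map-++ _ Γ Δ)))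
      (⊗-I (cast (rename-update σ _ d)
        (sub-typed _ (update-injective (fn P) (λ a b → inj (there a) (there b)) (pick-∉ y _)) d)))
  sub-typed σ inj (1-I d) = 1-I (sub-typed σ (λ a b → inj (there a) (there b)) d)
  sub-typed {x ⦅ y ⦆· P} σ inj (⅋-I d) =
    ⅋-I (cast (rename-update σ _ d)
      (sub-typed _ (update-injective (fn P) (λ a b → inj (there a) (there b)) (pick-∉ y _)) d))
  sub-typed σ inj r@(⊥-I {Γ = Γ} x∉ d) =
    ⊥-I (rename-∉ Γ inj (here refl) (names⊆fn r ∘ here ∘ there) x∉)
        (sub-typed σ (λ a b → inj (there a) (there b)) d)
  sub-typed σ inj (⊕-I₁ d) = ⊕-I₁ (sub-typed σ (λ a b → inj (there a) (there b)) d)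
  sub-typed σ inj (⊕-I₂ d) = ⊕-I₂ (sub-typed σ (λ a b → inj (there a) (there b)) d)
  sub-typed {x ▹⦅ P ∣ Q ⦆} σ inj (&-I d e) =
    &-I (sub-typed σ (λ a b → inj (there (∈-++⁺ˡ a)) (there (∈-++⁺ˡ b))) d)
        (sub-typed σ (λ a b → inj (there (∈-++⁺ʳ (fn P) a)) (there (∈-++⁺ʳ (fn P) b))) e)
  sub-typed {x !⦅ y ⦆· P} σ inj r@(!-I {Γ = Γ} ⁇Γ x∉ d) =
    !-I (rename-AllWhyNot σ ⁇Γ) (rename-∉ Γ inj (here refl) (names⊆fn r ∘ here ∘ there) x∉)
      (cast (rename-update σ _ d)
        (sub-typed _ (update-injective (fn P) (λ a b → inj (there a) (there b)) (pick-∉ y _)) d))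
  sub-typed {x ?⟦ y ⟧· P} σ inj r@(?-I {Γ = Γ} x∉ d) =
    ?-I (rename-∉ Γ inj (here refl) (names⊆fn r ∘ here ∘ there) x∉)
      (cast (rename-update σ _ d)
        (sub-typed _ (update-injective (fn P) (λ a b → inj (there a) (there b)) (pick-∉ y _)) d))
  sub-typed σ inj r@(W {Γ = Γ} x∉ d) =
    W (rename-∉ Γ inj (here refl) (names⊆fn r ∘ here ∘ there) x∉)
      (sub-typed σ (λ a b → inj (there a) (there b)) d)
  sub-typed {x ?⟦ y₁ ∣ y₂ ⟧· P} σ inj r@(C {Γ = Γ} {A = A} x∉ d) =
    C (rename-∉ Γ inj (here refl) (names⊆fn r ∘ here ∘ there) x∉)
      (cast (cong [_] eq)
        (sub-typed σ′ (update₂-injective (fn P) (λ a b → inj (there a) (there b)) y₁′∉ y₂′∉) d))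
    where
    y₁′ = pick y₁ (map σ (fn P ∖ y₁ ∖ y₂))
    y₂′ = pick y₂ (y₁′ ∷ map σ (fn P ∖ y₁ ∖ y₂))
    y₁′∉ = pick-∉ y₁ (map σ (fn P ∖ y₁ ∖ y₂))
    y₂′∉ = pick-∉ y₂ (y₁′ ∷ map σ (fn P ∖ y₁ ∖ y₂))
    σ′ = σ [ y₁ ↦ y₁′ ] [ y₂ ↦ y₂′ ]
    d′ : ⊢ P ⦂ [ (y₂ , ⁇ A) ∷ (y₁ , ⁇ A) ∷ Γ ]
    d′ = exch (single-≋ (_↭_.swap (y₁ , ⁇ A) (y₂ , ⁇ A) ↭-refl)) d
    eq : renameᵉ σ′ ((y₁ , ⁇ A) ∷ (y₂ , ⁇ A) ∷ Γ) ≡ (y₁′ , ⁇ A) ∷ (y₂′ , ⁇ A) ∷ renameᵉ σ Γ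
    eq = cong₂ (λ z Θ → (z , ⁇ A) ∷ Θ)
           (update₂-≡ σ y₁ y₁′ y₂ y₂′ (head-fresh d′ (here (here refl))))
           (cong₂ (λ z Θ → (z , ⁇ A) ∷ Θ) (update-≡ _ y₂ y₂′)
             (renameᵉ-cong Γ λ p → update₂-≢ σ y₁ y₁′ y₂ y₂′ (head-fresh d (here (there p)))
                                                             (head-fresh d′ (here (there p)))))
  sub-typed σ inj (∃-I d) = ∃-I (sub-typed σ (λ a b → inj (there a) (there b)) d)
  sub-typed σ inj (∀-I {Γ = Γ} d) =
    ∀-I (cast (cong (λ Θ → [ _ ∷ Θ ]) (rename-weaken σ Γ))
          (sub-typed σ (λ a b → inj (there a) (there b)) d))

  -- Substitution of types in processes

  subᵉ : (ℕ → Type) → Env → Env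
  subᵉ θ = map (map₂ (subᵗ θ))

  subʰ : (ℕ → Type) → HEnv → HEnv
  subʰ θ = map (subᵉ θ)

  dom-subᵉ : ∀ θ Γ → dom (subᵉ θ Γ) ≡ dom Γ
  dom-subᵉ θ Γ = sym (map-∘ Γ)

  names-subʰ : ∀ θ 𝒢 → names (subʰ θ 𝒢) ≡ names 𝒢
  names-subʰ θ []      = refl
  names-subʰ θ (Γ ∷ 𝒢) =
    trans (map-++ proj₁ (subᵉ θ Γ) (concat (subʰ θ 𝒢)))
      (trans (cong₂ _++_ (dom-subᵉ θ Γ) (names-subʰ θ 𝒢)) (sym (map-++ proj₁ Γ (concat 𝒢))))

  subᵉ-weaken : ∀ θ Γ → subᵉ (lift θ) (weaken Γ) ≡ weaken (subᵉ θ Γ)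
  subᵉ-weaken θ Γ = trans (sym (map-∘ Γ))
                      (trans (map-cong (λ (x , A) → cong (x ,_) (subᵗ-weaken θ A)) Γ) (map-∘ Γ))

  subᵖ-typed : ∀ {P 𝒢} θ → ⊢ P ⦂ 𝒢 → ⊢ subᵖ θ P ⦂ subʰ θ 𝒢
  subᵖ-typed θ (exch e d) = exch (≋ₚ.map⁺ ↭-setoid (↭.map⁺ _) e) (subᵖ-typed θ d)
  subᵖ-typed θ (ax {x} {y} {A} x≢y) =
    subst (λ B → ⊢ x ↔ y ⦂ [ (x , B) ∷ (y , subᵗ θ A) ∷ [] ]) (sym (subᵗ-^⊥ θ A)) (ax x≢y)
  subᵖ-typed θ (cut {𝒢 = 𝒢} {Γ} {Δ} {x} {y} {A} d) =
    cast (cong (_∷ _) (sym (map-++ _ Γ Δ)))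
      (cut (subst (λ B → ⊢ _ ⦂ ((x , subᵗ θ A) ∷ subᵉ θ Γ) ∷ ((y , B) ∷ subᵉ θ Δ) ∷ subʰ θ 𝒢)
                  (subᵗ-^⊥ θ A) (subᵖ-typed θ d)))
  subᵖ-typed θ (mix {𝒢 = 𝒢} {ℋ} 𝒢#ℋ d e) =
    cast (sym (map-++ _ 𝒢 ℋ))
      (mix (subst₂ Disjoint (sym (names-subʰ θ 𝒢)) (sym (names-subʰ θ ℋ)) 𝒢#ℋ)
           (subᵖ-typed θ d) (subᵖ-typed θ e))
  subᵖ-typed θ mix₀ = mix₀
  subᵖ-typed θ (⊗-I {Γ = Γ} {Δ} d) =
    cast (cong (λ Θ → [ _ ∷ Θ ]) (sym (map-++ _ Γ Δ))) (⊗-I (subᵖ-typed θ d))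
  subᵖ-typed θ (1-I d) = 1-I (subᵖ-typed θ d)
  subᵖ-typed θ (⅋-I d) = ⅋-I (subᵖ-typed θ d)
  subᵖ-typed θ (⊥-I {Γ = Γ} x∉ d) = ⊥-I (subst (_ ∉_) (sym (dom-subᵉ θ Γ)) x∉) (subᵖ-typed θ d)
  subᵖ-typed θ (⊕-I₁ d) = ⊕-I₁ (subᵖ-typed θ d)
  subᵖ-typed θ (⊕-I₂ d) = ⊕-I₂ (subᵖ-typed θ d)
  subᵖ-typed θ (&-I d e) = &-I (subᵖ-typed θ d) (subᵖ-typed θ e)
  subᵖ-typed θ (!-I {Γ = Γ} ⁇Γ x∉ d) =
    !-I (All.map⁺ (All.map (λ { (B , refl) → subᵗ θ B , refl }) ⁇Γ))
        (subst (_ ∉_) (sym (dom-subᵉ θ Γ)) x∉) (subᵖ-typed θ d)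
  subᵖ-typed θ (?-I {Γ = Γ} x∉ d) = ?-I (subst (_ ∉_) (sym (dom-subᵉ θ Γ)) x∉) (subᵖ-typed θ d)
  subᵖ-typed θ (W {Γ = Γ} x∉ d) = W (subst (_ ∉_) (sym (dom-subᵉ θ Γ)) x∉) (subᵖ-typed θ d)
  subᵖ-typed θ (C {Γ = Γ} x∉ d) = C (subst (_ ∉_) (sym (dom-subᵉ θ Γ)) x∉) (subᵖ-typed θ d)
  subᵖ-typed θ (∃-I {Γ = Γ} {x} {A} {B} d) =
    ∃-I (subst (λ T → ⊢ _ ⦂ [ (x , T) ∷ subᵉ θ Γ ]) (subᵗ-[]ᵗ θ B A) (subᵖ-typed θ d))
  subᵖ-typed θ (∀-I {Γ = Γ} d) =
    ∀-I (cast (cong (λ Θ → [ _ ∷ Θ ]) (subᵉ-weaken θ Γ)) (subᵖ-typed (lift θ) d))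

  -- The side condition of the rule for universal types is encoded by `weaken`; this is its use:
  -- instantiating the bound variable leaves the context alone.
  subᵉ-single-weaken : ∀ A Γ → subᵉ (single A) (weaken Γ) ≡ Γ
  subᵉ-single-weaken A []            = refl
  subᵉ-single-weaken A ((x , B) ∷ Γ) =
    cong₂ (λ T Θ → (x , T) ∷ Θ) (single-renᵗ-suc A B) (subᵉ-single-weaken A Γ)

  -- α-equivalence

  swap-≡ˡ : ∀ a b → swap a b a ≡ b
  swap-≡ˡ a b with a ≟ a
  ... | yes _  = refl
  ... | no a≢a = contradiction refl a≢a

  swap-≡ʳ : ∀ a b → swap a b b ≡ a
  swap-≡ʳ a b with b ≟ a | b ≟ b
  ... | yes b≡a | _      = b≡a
  ... | no _    | yes _  = refl
  ... | no _    | no b≢b = contradiction refl b≢b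

  swap-≢ : ∀ a b {x} → x ≢ a → x ≢ b → swap a b x ≡ x
  swap-≢ a b {x} x≢a x≢b with x ≟ a | x ≟ b
  ... | yes x≡a | _       = contradiction x≡a x≢a
  ... | no _    | yes x≡b = contradiction x≡b x≢b
  ... | no _    | no _    = refl

  swap-inverse : ∀ a b x → swap b a (swap a b x) ≡ x
  swap-inverse a b x with x ≟ a | x ≟ b
  ... | yes refl | _        = swap-≡ˡ b x
  ... | no _     | yes refl = swap-≡ʳ x a
  ... | no x≢a   | no x≢b   = swap-≢ b a x≢b x≢a

  swap-injective : ∀ a b {x y} → swap a b x ≡ swap a b y → x ≡ y
  swap-injective a b {x} {y} e =
    trans (sym (swap-inverse a b x)) (trans (cong (swap b a) e) (swap-inverse a b y))

  replace-inverse : ∀ s t → (∀ x → s (t x) ≡ x) → ∀ P → replace s (replace t P) ≡ P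
  replace-inverse s t e (x ⟦ y ⟧· P)
    rewrite e x | e y | replace-inverse s t e P = refl
  replace-inverse s t e (x ⦅ y ⦆· P)
    rewrite e x | e y | replace-inverse s t e P = refl
  replace-inverse s t e (x ⟦⟧· P)     rewrite e x | replace-inverse s t e P = refl
  replace-inverse s t e (x ⦅⦆· P)     rewrite e x | replace-inverse s t e P = refl
  replace-inverse s t e (x ⟦inl⟧· P)  rewrite e x | replace-inverse s t e P = refl
  replace-inverse s t e (x ⟦inr⟧· P)  rewrite e x | replace-inverse s t e P = refl
  replace-inverse s t e (x ▹⦅ P ∣ Q ⦆)
    rewrite e x | replace-inverse s t e P | replace-inverse s t e Q = refl
  replace-inverse s t e (x ⟦ A ⟧ᵗ· P) rewrite e x | replace-inverse s t e P = refl
  replace-inverse s t e (x ⦅X⦆· P)    rewrite e x | replace-inverse s t e P = refl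
  replace-inverse s t e (x !⦅ y ⦆· P)
    rewrite e x | e y | replace-inverse s t e P = refl
  replace-inverse s t e (x ?⟦ y ⟧· P)
    rewrite e x | e y | replace-inverse s t e P = refl
  replace-inverse s t e (x ?⟦ x₁ ∣ x₂ ⟧· P)
    rewrite e x | e x₁ | e x₂ | replace-inverse s t e P = refl
  replace-inverse s t e (x ?⟦⟧· P)    rewrite e x | replace-inverse s t e P = refl
  replace-inverse s t e (⦅ν x ∣ y ⦆ P)
    rewrite e x | e y | replace-inverse s t e P = refl
  replace-inverse s t e (P ∥ Q)       =
    cong₂ _∥_ (replace-inverse s t e P) (replace-inverse s t e Q)
  replace-inverse s t e 𝟎             = refl
  replace-inverse s t e (x ↔ y)       = cong₂ _↔_ (e x) (e y)

  rename-swap : ∀ {P y A Γ 𝒢 z} → ⊢ P ⦂ ((y , A) ∷ Γ) ∷ 𝒢 → (∀ {w} → w ∈ʰ Γ ∷ 𝒢 → w ≢ z) →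
                renameʰ (swap y z) (((y , A) ∷ Γ) ∷ 𝒢) ≡ ((z , A) ∷ Γ) ∷ 𝒢
  rename-swap {y = y} {A} {Γ} {𝒢} {z} d ≢z =
    cong₂ (λ w (Δ , ℋ) → ((w , A) ∷ Δ) ∷ ℋ) (swap-≡ˡ y z)
      (cong₂ _,_ (trans (renameᵉ-cong Γ (agree ∘ here)) (renameᵉ-id Γ))
                 (trans (renameʰ-cong 𝒢 (agree ∘ there)) (renameʰ-id 𝒢)))
    where
    agree : ∀ {w} → w ∈ʰ Γ ∷ 𝒢 → swap y z w ≡ w
    agree p = swap-≢ y z (head-fresh d p) (≢z p)

  swap-head : ∀ {P y A Γ 𝒢 z} → z ∉ fn P → ⊢ P ⦂ ((y , A) ∷ Γ) ∷ 𝒢 →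
              ⊢ ⟨ y ⇄ z ⟩ P ⦂ ((z , A) ∷ Γ) ∷ 𝒢
  swap-head {P} {y} {A} {Γ} {𝒢} {z} z∉ d =
    cast (rename-swap d λ { p refl → z∉ (names⊆fn d (∈ʰ-∷ p)) })
         (replace-typed (swap-injective y z) d)

  -- Swapping back types `P` in the swapped hyperenvironment. If `y` occurred in `Γ` or `𝒢`, it
  -- would be turned into `z`, making `z` free in `P`; hence the swap changes only the head.
  swap-head⁻ : ∀ {P y A Γ 𝒢 z} → z ∉ fn P → ⊢ ⟨ y ⇄ z ⟩ P ⦂ ((z , A) ∷ Γ) ∷ 𝒢 →
               ⊢ P ⦂ ((y , A) ∷ Γ) ∷ 𝒢
  swap-head⁻ {P} {y} {A} {Γ} {𝒢} {z} z∉ d = cast (rename-swap d ≢y) d′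
    where
    d′ : ⊢ P ⦂ renameʰ (swap z y) (((z , A) ∷ Γ) ∷ 𝒢)
    d′ = subst (⊢_⦂ _) (replace-inverse (swap z y) (swap y z) (swap-inverse y z) P)
               (replace-typed (swap-injective z y) d)
    ≢y : ∀ {w} → w ∈ʰ Γ ∷ 𝒢 → w ≢ y
    ≢y p refl = z∉ (names⊆fn d′
      (subst (_∈ʰ renameʰ (swap z y) (((z , A) ∷ Γ) ∷ 𝒢)) (swap-≡ʳ z y)
             (∈ʰ-rename⁺ (swap z y) (∈ʰ-∷ p))))

  infix 4 _⊴_

  -- Taking the result for the continuation as a function lets each congruence lemma recurse on the
  -- typing derivation alone, through its `exch` steps. The hyperenvironment must be kept, since the
  -- rule is reapplied to it.
  _⊴_ : Proc → Proc → Set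
  P ⊴ Q = ∀ {𝒢} → ⊢ P ⦂ 𝒢 → ⊢ Q ⦂ 𝒢

  ⊴-⟦⟧ : ∀ {x y P Q} → P ⊴ Q → x ⟦ y ⟧· P ⊴ x ⟦ y ⟧· Q
  ⊴-⟦⟧ f (exch e d) = exch e (⊴-⟦⟧ f d)
  ⊴-⟦⟧ f (⊗-I d) = ⊗-I (f d)

  ⊴-⦅⦆ : ∀ {x y P Q} → P ⊴ Q → x ⦅ y ⦆· P ⊴ x ⦅ y ⦆· Q
  ⊴-⦅⦆ f (exch e d) = exch e (⊴-⦅⦆ f d)
  ⊴-⦅⦆ f (⅋-I d) = ⅋-I (f d)

  ⊴-1 : ∀ {x P Q} → P ⊴ Q → x ⟦⟧· P ⊴ x ⟦⟧· Q
  ⊴-1 f (exch e d) = exch e (⊴-1 f d)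
  ⊴-1 f (1-I d) = 1-I (f d)

  ⊴-⊥ : ∀ {x P Q} → P ⊴ Q → x ⦅⦆· P ⊴ x ⦅⦆· Q
  ⊴-⊥ f (exch e d) = exch e (⊴-⊥ f d)
  ⊴-⊥ f (⊥-I a d) = ⊥-I a (f d)

  ⊴-inl : ∀ {x P Q} → P ⊴ Q → x ⟦inl⟧· P ⊴ x ⟦inl⟧· Q
  ⊴-inl f (exch e d) = exch e (⊴-inl f d)
  ⊴-inl f (⊕-I₁ d) = ⊕-I₁ (f d)

  ⊴-inr : ∀ {x P Q} → P ⊴ Q → x ⟦inr⟧· P ⊴ x ⟦inr⟧· Q
  ⊴-inr f (exch e d) = exch e (⊴-inr f d)
  ⊴-inr f (⊕-I₂ d) = ⊕-I₂ (f d)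

  ⊴-∃ : ∀ {x A P Q} → P ⊴ Q → x ⟦ A ⟧ᵗ· P ⊴ x ⟦ A ⟧ᵗ· Q
  ⊴-∃ f (exch e d) = exch e (⊴-∃ f d)
  ⊴-∃ f (∃-I d) = ∃-I (f d)

  ⊴-∀ : ∀ {x P Q} → P ⊴ Q → x ⦅X⦆· P ⊴ x ⦅X⦆· Q
  ⊴-∀ f (exch e d) = exch e (⊴-∀ f d)
  ⊴-∀ f (∀-I d) = ∀-I (f d)

  ⊴-! : ∀ {x y P Q} → P ⊴ Q → x !⦅ y ⦆· P ⊴ x !⦅ y ⦆· Q
  ⊴-! f (exch e d) = exch e (⊴-! f d)
  ⊴-! f (!-I a b d) = !-I a b (f d)

  ⊴-? : ∀ {x y P Q} → P ⊴ Q → x ?⟦ y ⟧· P ⊴ x ?⟦ y ⟧· Q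
  ⊴-? f (exch e d) = exch e (⊴-? f d)
  ⊴-? f (?-I a d) = ?-I a (f d)

  ⊴-C : ∀ {x x₁ x₂ P Q} → P ⊴ Q → x ?⟦ x₁ ∣ x₂ ⟧· P ⊴ x ?⟦ x₁ ∣ x₂ ⟧· Q
  ⊴-C f (exch e d) = exch e (⊴-C f d)
  ⊴-C f (C a d) = C a (f d)

  ⊴-W : ∀ {x P Q} → P ⊴ Q → x ?⟦⟧· P ⊴ x ?⟦⟧· Q
  ⊴-W f (exch e d) = exch e (⊴-W f d)
  ⊴-W f (W a d) = W a (f d)

  ⊴-ν : ∀ {x y P Q} → P ⊴ Q → ⦅ν x ∣ y ⦆ P ⊴ ⦅ν x ∣ y ⦆ Q
  ⊴-ν f (exch e d) = exch e (⊴-ν f d)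
  ⊴-ν f (cut d) = cut (f d)

  ⊴-▹ : ∀ {x P P′ Q Q′} → P ⊴ P′ → Q ⊴ Q′ → x ▹⦅ P ∣ Q ⦆ ⊴ x ▹⦅ P′ ∣ Q′ ⦆
  ⊴-▹ f g (exch e d)  = exch e (⊴-▹ f g d)
  ⊴-▹ f g (&-I d₁ d₂) = &-I (f d₁) (g d₂)

  ⊴-∥ : ∀ {P P′ Q Q′} → P ⊴ P′ → Q ⊴ Q′ → P ∥ Q ⊴ P′ ∥ Q′
  ⊴-∥ f g (exch e d)      = exch e (⊴-∥ f g d)
  ⊴-∥ f g (mix 𝒢#ℋ d₁ d₂) = mix 𝒢#ℋ (f d₁) (g d₂)

  ν-comm-⊴ : ∀ {x y P} → ⦅ν x ∣ y ⦆ P ⊴ ⦅ν y ∣ x ⦆ P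
  ν-comm-⊴ (exch e d) = exch e (ν-comm-⊴ d)
  ν-comm-⊴ {x} {y} {P} (cut {𝒢 = 𝒢} {Γ} {Δ} {A = A} d) =
    exch (single-≋ (↭.++-comm Δ Γ))
      (cut (subst (λ B → ⊢ P ⦂ ((y , A ^⊥) ∷ Δ) ∷ ((x , B) ∷ Γ) ∷ 𝒢) (sym (^⊥-involutive A))
                  (exch swap-≋ d)))

  swap-heads : ∀ {P Γ 𝒢} {e f : Name × Type} → ⊢ P ⦂ (e ∷ f ∷ Γ) ∷ 𝒢 → ⊢ P ⦂ (f ∷ e ∷ Γ) ∷ 𝒢
  swap-heads = exch (single-≋ (_↭_.swap _ _ ↭-refl))

  rename-⟦⟧ : ∀ {x y z P} → z ∉ fn P → x ⟦ y ⟧· P ⊴ x ⟦ z ⟧· ⟨ y ⇄ z ⟩ P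
  rename-⟦⟧ z∉ (exch e d) = exch e (rename-⟦⟧ z∉ d)
  rename-⟦⟧ z∉ (⊗-I d) = ⊗-I (swap-head z∉ d)

  rename⁻-⟦⟧ : ∀ {x y z P} → z ∉ fn P → x ⟦ z ⟧· ⟨ y ⇄ z ⟩ P ⊴ x ⟦ y ⟧· P
  rename⁻-⟦⟧ z∉ (exch e d) = exch e (rename⁻-⟦⟧ z∉ d)
  rename⁻-⟦⟧ z∉ (⊗-I d) = ⊗-I (swap-head⁻ z∉ d)

  rename-⦅⦆ : ∀ {x y z P} → z ∉ fn P → x ⦅ y ⦆· P ⊴ x ⦅ z ⦆· ⟨ y ⇄ z ⟩ P
  rename-⦅⦆ z∉ (exch e d) = exch e (rename-⦅⦆ z∉ d)
  rename-⦅⦆ z∉ (⅋-I d) = ⅋-I (swap-head z∉ d)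

  rename⁻-⦅⦆ : ∀ {x y z P} → z ∉ fn P → x ⦅ z ⦆· ⟨ y ⇄ z ⟩ P ⊴ x ⦅ y ⦆· P
  rename⁻-⦅⦆ z∉ (exch e d) = exch e (rename⁻-⦅⦆ z∉ d)
  rename⁻-⦅⦆ z∉ (⅋-I d) = ⅋-I (swap-head⁻ z∉ d)

  rename-! : ∀ {x y z P} → z ∉ fn P → x !⦅ y ⦆· P ⊴ x !⦅ z ⦆· ⟨ y ⇄ z ⟩ P
  rename-! z∉ (exch e d) = exch e (rename-! z∉ d)
  rename-! z∉ (!-I a b d) = !-I a b (swap-head z∉ d)

  rename⁻-! : ∀ {x y z P} → z ∉ fn P → x !⦅ z ⦆· ⟨ y ⇄ z ⟩ P ⊴ x !⦅ y ⦆· P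
  rename⁻-! z∉ (exch e d) = exch e (rename⁻-! z∉ d)
  rename⁻-! z∉ (!-I a b d) = !-I a b (swap-head⁻ z∉ d)

  rename-? : ∀ {x y z P} → z ∉ fn P → x ?⟦ y ⟧· P ⊴ x ?⟦ z ⟧· ⟨ y ⇄ z ⟩ P
  rename-? z∉ (exch e d) = exch e (rename-? z∉ d)
  rename-? z∉ (?-I a d) = ?-I a (swap-head z∉ d)

  rename⁻-? : ∀ {x y z P} → z ∉ fn P → x ?⟦ z ⟧· ⟨ y ⇄ z ⟩ P ⊴ x ?⟦ y ⟧· P
  rename⁻-? z∉ (exch e d) = exch e (rename⁻-? z∉ d)
  rename⁻-? z∉ (?-I a d) = ?-I a (swap-head⁻ z∉ d)

  rename-?₁ : ∀ {x x₂ y z P} → z ∉ fn P → x ?⟦ y ∣ x₂ ⟧· P ⊴ x ?⟦ z ∣ x₂ ⟧· ⟨ y ⇄ z ⟩ P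
  rename-?₁ z∉ (exch e d) = exch e (rename-?₁ z∉ d)
  rename-?₁ z∉ (C a d) = C a (swap-head z∉ d)

  rename⁻-?₁ : ∀ {x x₂ y z P} → z ∉ fn P → x ?⟦ z ∣ x₂ ⟧· ⟨ y ⇄ z ⟩ P ⊴ x ?⟦ y ∣ x₂ ⟧· P
  rename⁻-?₁ z∉ (exch e d) = exch e (rename⁻-?₁ z∉ d)
  rename⁻-?₁ z∉ (C a d) = C a (swap-head⁻ z∉ d)

  rename-?₂ : ∀ {x x₁ y z P} → z ∉ fn P → x ?⟦ x₁ ∣ y ⟧· P ⊴ x ?⟦ x₁ ∣ z ⟧· ⟨ y ⇄ z ⟩ P
  rename-?₂ z∉ (exch e d) = exch e (rename-?₂ z∉ d)
  rename-?₂ z∉ (C a d) = C a (swap-heads (swap-head z∉ (swap-heads d)))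

  rename⁻-?₂ : ∀ {x x₁ y z P} → z ∉ fn P → x ?⟦ x₁ ∣ z ⟧· ⟨ y ⇄ z ⟩ P ⊴ x ?⟦ x₁ ∣ y ⟧· P
  rename⁻-?₂ z∉ (exch e d) = exch e (rename⁻-?₂ z∉ d)
  rename⁻-?₂ z∉ (C a d) = C a (swap-heads (swap-head⁻ z∉ (swap-heads d)))

  rename-ν : ∀ {x y z P} → z ∉ fn P → ⦅ν y ∣ x ⦆ P ⊴ ⦅ν z ∣ x ⦆ ⟨ y ⇄ z ⟩ P
  rename-ν z∉ (exch e d) = exch e (rename-ν z∉ d)
  rename-ν z∉ (cut d) = cut (swap-head z∉ d)

  rename⁻-ν : ∀ {x y z P} → z ∉ fn P → ⦅ν z ∣ x ⦆ ⟨ y ⇄ z ⟩ P ⊴ ⦅ν y ∣ x ⦆ P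
  rename⁻-ν z∉ (exch e d) = exch e (rename⁻-ν z∉ d)
  rename⁻-ν z∉ (cut d) = cut (swap-head⁻ z∉ d)

  -- The two directions are proved together because `α-sym` exchanges them.
  α-typed : ∀ {P Q} → P =α Q → P ⊴ Q × Q ⊴ P
  α-typed (α-⟦⟧ z∉) = rename-⟦⟧ z∉ , rename⁻-⟦⟧ z∉
  α-typed (α-⦅⦆ z∉) = rename-⦅⦆ z∉ , rename⁻-⦅⦆ z∉
  α-typed (α-! z∉) = rename-! z∉ , rename⁻-! z∉
  α-typed (α-? z∉) = rename-? z∉ , rename⁻-? z∉
  α-typed (α-?₁ _ _ z∉) = rename-?₁ z∉ , rename⁻-?₁ z∉
  α-typed (α-?₂ _ _ z∉) = rename-?₂ z∉ , rename⁻-?₂ z∉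
  α-typed (α-ν _ _ z∉) = rename-ν z∉ , rename⁻-ν z∉
  α-typed ν-comm = ν-comm-⊴ , ν-comm-⊴
  α-typed α-refl = (λ d → d) , (λ d → d)
  α-typed (α-sym e) = let f , g = α-typed e in g , f
  α-typed (α-trans e e′) =
    let f , g = α-typed e ; f′ , g′ = α-typed e′ in (λ d → f′ (f d)) , (λ d → g (g′ d))
  α-typed (c-⟦⟧ e) = let f , g = α-typed e in ⊴-⟦⟧ f , ⊴-⟦⟧ g
  α-typed (c-⦅⦆ e) = let f , g = α-typed e in ⊴-⦅⦆ f , ⊴-⦅⦆ g
  α-typed (c-1 e) = let f , g = α-typed e in ⊴-1 f , ⊴-1 g
  α-typed (c-⊥ e) = let f , g = α-typed e in ⊴-⊥ f , ⊴-⊥ g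
  α-typed (c-inl e) = let f , g = α-typed e in ⊴-inl f , ⊴-inl g
  α-typed (c-inr e) = let f , g = α-typed e in ⊴-inr f , ⊴-inr g
  α-typed (c-∃ e) = let f , g = α-typed e in ⊴-∃ f , ⊴-∃ g
  α-typed (c-∀ e) = let f , g = α-typed e in ⊴-∀ f , ⊴-∀ g
  α-typed (c-! e) = let f , g = α-typed e in ⊴-! f , ⊴-! g
  α-typed (c-? e) = let f , g = α-typed e in ⊴-? f , ⊴-? g
  α-typed (c-C e) = let f , g = α-typed e in ⊴-C f , ⊴-C g
  α-typed (c-W e) = let f , g = α-typed e in ⊴-W f , ⊴-W g
  α-typed (c-ν e) = let f , g = α-typed e in ⊴-ν f , ⊴-ν g
  α-typed (c-▹ e e′) = let f , g = α-typed e ; f′ , g′ = α-typed e′ in ⊴-▹ f f′ , ⊴-▹ g g′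
  α-typed (c-∥ e e′) = let f , g = α-typed e ; f′ , g′ = α-typed e′ in ⊴-∥ f f′ , ⊴-∥ g g′

  -- Transitions of hyperenvironments

  -- Splitting at the position of `Δ` in `Γ ∷ 𝒢`: an empty prefix means that the two heads
  -- correspond, and a nonempty one begins with a copy of `Γ`. It decides whether a step acts in an
  -- environment that a cut singles out.
  cons-cons : ∀ {Γ Δ : Env} {𝒢 ℋ} → Γ ∷ 𝒢 ≋ Δ ∷ ℋ →
              (Γ ↭ Δ × 𝒢 ≋ ℋ) ⊎ (∃ λ ℱ → 𝒢 ≋ Δ ∷ ℱ × ℋ ≋ Γ ∷ ℱ)
  cons-cons {Γ} {Δ} {𝒢} {ℋ} e with ≋ₚ.↭-split Δ [] ℋ e
  ... | []     , qs , p ∷ ps , r = inj₁ (p , ≋.↭-trans (Homogeneous.refl ps) r)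
  ... | Ξ ∷ ℱ , qs , p ∷ ps , r =
    inj₂ (ℱ ++ qs , ≋.↭-trans (Homogeneous.refl ps) (≋ₚ.↭-shift ℱ qs) ,
          ≋.↭-trans (≋.↭-sym r) (single-≋ (↭-sym p)))

  -- `r-1` produces no environment and `r-⊗` two. In `r-?W` and `r-?C` the types are those of the
  -- prefixes `x ⦅⦆·` and `x₁ ⦅ x₂ ⦆·` left by `disp` and `dup`, and `r-!W` and `r-!C` produce their
  -- duals, so that the partners can be cut again. `x₂` remains bound in the residual and hence is
  -- in no environment.
  data Rule : Act → Type → HEnv → Set where
    r-1  : ∀ {x} → Rule (x ⟦⟧) 𝟏 []
    r-⊥  : ∀ {x} → Rule (x ⦅⦆) ⊥ᵗ [ [] ]
    r-⊗  : ∀ {x y A B} → Rule (x ⟦ y ⟧) (A ⊗ B) ([ (y , A) ] ∷ [ (x , B) ] ∷ [])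
    r-⅋  : ∀ {x y A B} → Rule (x ⦅ y ⦆) (A ⅋ B) [ (y , A) ∷ (x , B) ∷ [] ]
    r-⊕₁ : ∀ {x A B} → Rule (x ⟦inl⟧) (A ⊕ B) [ [ (x , A) ] ]
    r-⊕₂ : ∀ {x A B} → Rule (x ⟦inr⟧) (A ⊕ B) [ [ (x , B) ] ]
    r-&₁ : ∀ {x A B} → Rule (x ⦅inl⦆) (A & B) [ [ (x , A) ] ]
    r-&₂ : ∀ {x A B} → Rule (x ⦅inr⦆) (A & B) [ [ (x , B) ] ]
    r-?  : ∀ {x y A} → Rule (x ?⟦ y ⟧) (⁇ A) [ [ (y , A) ] ]
    r-!  : ∀ {x y A} → Rule (x !⦅ y ⦆) (! A) [ [ (y , A) ] ]
    r-?C : ∀ {x x₁ x₂ A} → Rule (x ?⟦ x₁ ∣ x₂ ⟧) (⁇ A) [ [ (x₁ , ⁇ A ⅋ ⁇ A) ] ]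
    r-!C : ∀ {x x₁ x₂ A} → Rule (x !⦅ x₁ ∣ x₂ ⦆) (! A) [ [ (x₁ , ! A ⊗ ! A) ] ]
    r-?W : ∀ {x A} → Rule (x ?⟦⟧) (⁇ A) [ [ (x , ⊥ᵗ) ] ]
    r-!W : ∀ {x A} → Rule (x !⦅⦆) (! A) [ [ (x , 𝟏) ] ]
    r-∃  : ∀ {x A B} → Rule (x ⟦ A ⟧ᵗ) (∃ᵗ B) [ [ (x , B [ A ]ᵗ) ] ]
    r-∀  : ∀ {x A B} → Rule (x ⦅ A ⦆ᵗ) (∀ᵗ B) [ [ (x , B [ A ]ᵗ) ] ]

  -- A label consumes Σ and produces one environment for each element of Θ,
  -- among which the rest of the environment of Σ is distributed.
  data Ruleˡ : Label → Env → HEnv → Set where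
    act : ∀ {l T Θ} → Rule l T Θ → Ruleˡ (act l) [ (subject l , T) ] Θ
    fwd : ∀ {x y A} → Ruleˡ (x ↔ y) ((x , A ^⊥) ∷ (y , A) ∷ []) []

  infixr 5 _∷_

  -- When nothing is produced, the rest is forced to be empty: besides the consumed names, the
  -- environment of `x ⟦⟧` or of a forwarder contains nothing.
  data Distribute : HEnv → Env → HEnv → Set where
    []  : Distribute [] [] []
    _∷_ : ∀ {θ Θ Ξ 𝒦} Γ → Distribute Θ Ξ 𝒦 → Distribute (θ ∷ Θ) (Γ ++ Ξ) ((θ ++ Γ) ∷ 𝒦)

  data Step (l : Label) (𝒢 𝒢′ : HEnv) : Set where
    step : ∀ {Σ Θ Ξ ℋ 𝒦} → Ruleˡ l Σ Θ → 𝒢 ≋ (Σ ++ Ξ) ∷ ℋ →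
           Distribute Θ Ξ 𝒦 → 𝒢′ ≋ 𝒦 ++ ℋ → Step l 𝒢 𝒢′

  step-resp-≋ : ∀ {l 𝒢 ℋ 𝒢′ ℋ′} → 𝒢 ≋ ℋ → 𝒢′ ≋ ℋ′ → Step l 𝒢 𝒢′ → Step l ℋ ℋ′
  step-resp-≋ e e′ (step r f s f′) =
    step r (≋.↭-trans (≋.↭-sym e) f) s (≋.↭-trans (≋.↭-sym e′) f′)

  step-++ : ∀ {l 𝒢 𝒢′} ℱ → Step l 𝒢 𝒢′ → Step l (𝒢 ++ ℱ) (𝒢′ ++ ℱ)
  step-++ ℱ (step {ℋ = ℋ} {𝒦} r e s e′) =
    step r (≋ₚ.++⁺ʳ ℱ e) s (≋.↭-trans (≋ₚ.++⁺ʳ ℱ e′) (≋ₚ.++-assoc 𝒦 ℋ ℱ))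

  rule-names : ∀ {l T Θ z} → Rule l T Θ → z ∈ʰ Θ → z ≡ subject l ⊎ z ∈ bnᵃ l
  rule-names r-⊥  (here ())
  rule-names r-⊗  (here (here e))         = inj₂ (here e)
  rule-names r-⊗  (there (here (here e))) = inj₁ e
  rule-names r-⅋  (here (here e))         = inj₂ (here e)
  rule-names r-⅋  (here (there (here e))) = inj₁ e
  rule-names r-⊕₁ (here (here e))         = inj₁ e
  rule-names r-⊕₂ (here (here e))         = inj₁ e
  rule-names r-&₁ (here (here e))         = inj₁ e
  rule-names r-&₂ (here (here e))         = inj₁ e
  rule-names r-?  (here (here e))         = inj₂ (here e)
  rule-names r-!  (here (here e))         = inj₂ (here e)
  rule-names r-?C (here (here e))         = inj₂ (here e)
  rule-names r-!C (here (here e))         = inj₂ (here e)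
  rule-names r-?W (here (here e))         = inj₁ e
  rule-names r-!W (here (here e))         = inj₁ e
  rule-names r-∃  (here (here e))         = inj₁ e
  rule-names r-∀  (here (here e))         = inj₁ e

  ruleˡ-names : ∀ {l Σ Θ z} → Ruleˡ l Σ Θ → z ∈ʰ Θ → z ∈ dom Σ ⊎ z ∈ bnˡ l
  ruleˡ-names (act r) p with rule-names r p
  ... | inj₁ e = inj₁ (here e)
  ... | inj₂ q = inj₂ q

  ruleˡ-dom : ∀ {l Σ Θ z} → Ruleˡ l Σ Θ → z ∈ dom Σ → z ∈ fnˡ l
  ruleˡ-dom (act _) p = p
  ruleˡ-dom fwd     p = p

  distribute-names : ∀ {Θ Ξ 𝒦 z} → Distribute Θ Ξ 𝒦 → z ∈ʰ 𝒦 → z ∈ʰ Θ ⊎ z ∈ dom Ξ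
  distribute-names (_∷_ {θ} Γ s) (here p) with dom-++⁻ θ p
  ... | inj₁ q = inj₁ (here q)
  ... | inj₂ q = inj₂ (dom-++⁺ˡ _ q)
  distribute-names (Γ ∷ s) (there p) with distribute-names s p
  ... | inj₁ q = inj₁ (there q)
  ... | inj₂ q = inj₂ (dom-++⁺ʳ Γ q)

  -- Turns the side conditions of `par₁` and `par₂` into the disjointness that `mix` demands, and
  -- bounds the free names of residuals in `act-fn`.
  step-names : ∀ {l 𝒢 𝒢′ z} → Step l 𝒢 𝒢′ → z ∈ʰ 𝒢′ → z ∈ʰ 𝒢 ⊎ z ∈ bnˡ l
  step-names (step {Σ} {𝒦 = 𝒦} r e s e′) p with Any.++⁻ 𝒦 (∈ʰ-resp-≋ e′ p)
  ... | inj₂ q = inj₁ (∈ʰ-resp-≋ (≋.↭-sym e) (there q))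
  ... | inj₁ q with distribute-names s q
  ... | inj₂ q′ = inj₁ (∈ʰ-resp-≋ (≋.↭-sym e) (here (dom-++⁺ʳ Σ q′)))
  ... | inj₁ q′ with ruleˡ-names r q′
  ... | inj₁ q″ = inj₁ (∈ʰ-resp-≋ (≋.↭-sym e) (here (dom-++⁺ˡ _ q″)))
  ... | inj₂ q″ = inj₂ q″

  -- The environment that receives e can absorb a further Δ in place of e.
  distribute-focus : ∀ {Θ Ξ 𝒦} {e : Name × Type} → e ∈ Ξ → Distribute Θ Ξ 𝒦 →
    ∃[ Ξ₀ ] ∃[ Γ ] ∃[ 𝒦₀ ] Ξ ↭ e ∷ Ξ₀ × 𝒦 ≋ (e ∷ Γ) ∷ 𝒦₀ ×
    (∀ Δ → ∃[ Ξ₁ ] ∃[ 𝒦₁ ] Ξ₀ ++ Δ ↭ Ξ₁ × Distribute Θ Ξ₁ 𝒦₁ × 𝒦₁ ≋ (Γ ++ Δ) ∷ 𝒦₀)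
  distribute-focus {e = e} p (_∷_ {θ} {Ξ = Ξ} {𝒦} Γ s) with ∈-++⁻ Γ p
  ... | inj₁ q with ∈-∃++ q
  ... | as , bs , refl =
    (as ++ bs) ++ Ξ , θ ++ as ++ bs , 𝒦 , ↭.++⁺ʳ Ξ (↭.shift e as bs) ,
    single-≋ (↭-trans (↭.++⁺ˡ θ (↭.shift e as bs)) (↭.shift e θ (as ++ bs))) ,
    λ Δ → ((as ++ bs) ++ Δ) ++ Ξ , (θ ++ (as ++ bs) ++ Δ) ∷ 𝒦 ,
          ↭-trans (↭-reflexive (++-assoc (as ++ bs) Ξ Δ))
            (↭-trans (↭.++⁺ˡ (as ++ bs) (↭.++-comm Ξ Δ))
              (↭-reflexive (sym (++-assoc (as ++ bs) Δ Ξ)))) ,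
          ((as ++ bs) ++ Δ) ∷ s ,
          single-≋ (↭-reflexive (sym (++-assoc θ (as ++ bs) Δ)))
  distribute-focus {e = e} p (_∷_ {θ} {Ξ = Ξ} {𝒦} Γ s) | inj₂ q with distribute-focus q s
  ... | Ξ₀ , Γ₀ , 𝒦₀ , r , f , absorb =
    Γ ++ Ξ₀ , Γ₀ , (θ ++ Γ) ∷ 𝒦₀ , ↭-trans (↭.++⁺ˡ Γ r) (↭.shift e Γ Ξ₀) ,
    ≋.↭-trans (prep-≋ f) swap-≋ ,
    λ Δ → let Ξ₁ , 𝒦₁ , r₁ , s₁ , f₁ = absorb Δ in
          Γ ++ Ξ₁ , (θ ++ Γ) ∷ 𝒦₁ ,
          ↭-trans (↭-reflexive (++-assoc Γ Ξ₀ Δ)) (↭.++⁺ˡ Γ r₁) ,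
          Γ ∷ s₁ ,
          ≋.↭-trans (prep-≋ f₁) swap-≋

  -- Not being consumed, `a` belongs to the distributed rest and reaches a single resulting
  -- environment. What a cut on `a` would merge in before the step can therefore be merged into that
  -- environment after it.
  absorb-head : ∀ {Σ Θ Ξ 𝒦 a A Γ} → a ∉ dom Σ → (a , A) ∷ Γ ↭ Σ ++ Ξ → Distribute Θ Ξ 𝒦 →
    ∃[ Γ′ ] ∃[ 𝒦₀ ] 𝒦 ≋ ((a , A) ∷ Γ′) ∷ 𝒦₀ ×
    (∀ Δ → ∃[ Ξ₁ ] ∃[ 𝒦₁ ] Γ ++ Δ ↭ Σ ++ Ξ₁ × Distribute Θ Ξ₁ 𝒦₁ × 𝒦₁ ≋ (Γ′ ++ Δ) ∷ 𝒦₀)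
  absorb-head {Σ} {Ξ = Ξ} {a = a} {A} {Γ} a∉ r s with ∈-++⁻ Σ (↭.∈-resp-↭ r (here refl))
  ... | inj₁ p = contradiction (∈-map⁺ proj₁ p) a∉
  ... | inj₂ p with distribute-focus p s
  ... | Ξ₀ , Γ′ , 𝒦₀ , r₀ , f , absorb =
    Γ′ , 𝒦₀ , f ,
    λ Δ → let Ξ₁ , 𝒦₁ , r₁ , s₁ , f₁ = absorb Δ in
          Ξ₁ , 𝒦₁ ,
          ↭-trans (↭.++⁺ʳ Δ (↭.drop-∷ (↭-trans r (↭-trans (↭.++⁺ˡ Σ r₀) (↭.shift _ Σ Ξ₀)))))
            (↭-trans (↭-reflexive (++-assoc Σ Ξ₀ Δ)) (↭.++⁺ˡ Σ r₁)) ,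
          s₁ , f₁

  -- Up to two uses of `cons-cons` tell whether the label acts in the environment of `a`, in that of
  -- `b`, or elsewhere. In the first two cases the partner environment is glued to the piece that
  -- keeps the cut name, so `a` and `b` remain in distinct environments of `𝒢′`.
  step-cut : ∀ {l a b A B Γ Δ 𝒢 𝒢′} → a ∉ fnˡ l → b ∉ fnˡ l →
    Step l (((a , A) ∷ Γ) ∷ ((b , B) ∷ Δ) ∷ 𝒢) 𝒢′ →
    ∃[ Γ′ ] ∃[ Δ′ ] ∃[ 𝒢₀ ] 𝒢′ ≋ ((a , A) ∷ Γ′) ∷ ((b , B) ∷ Δ′) ∷ 𝒢₀ ×
    Step l ((Γ ++ Δ) ∷ 𝒢) ((Γ′ ++ Δ′) ∷ 𝒢₀)
  step-cut {a = a} {b} {A} {B} {Γ} {Δ} {𝒢} a∉ b∉ (step {Σ} {Ξ = Ξ} {ℋ} {𝒦} r e s e′)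
    with cons-cons e
  ... | inj₁ (p , f) =
    let Γ′ , 𝒦₀ , g , absorb = absorb-head (a∉ ∘ ruleˡ-dom r) p s
        Ξ₁ , 𝒦₁ , p₁ , s₁ , g₁ = absorb Δ
    in Γ′ , Δ , 𝒦₀ ++ 𝒢 ,
       ≋.↭-trans e′ (≋.↭-trans (≋ₚ.++⁺ g (≋.↭-sym f))
         (prep-≋ (≋ₚ.↭-shift 𝒦₀ 𝒢))) ,
       step r (single-≋ p₁) s₁ (≋.↭-sym (≋ₚ.++⁺ʳ 𝒢 g₁))
  ... | inj₂ (ℱ , f , f′) with cons-cons f
  ... | inj₁ (p , f″) =
    let Δ′ , 𝒦₀ , g , absorb = absorb-head (b∉ ∘ ruleˡ-dom r) p s
        Ξ₁ , 𝒦₁ , p₁ , s₁ , g₁ = absorb Γ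
    in Γ , Δ′ , 𝒦₀ ++ 𝒢 ,
       ≋.↭-trans e′ (≋.↭-trans (≋ₚ.++⁺ g (≋.↭-trans f′ (prep-≋ (≋.↭-sym f″))))
         (≋.↭-trans (prep-≋ (≋ₚ.↭-shift 𝒦₀ 𝒢)) swap-≋)) ,
       step r (single-≋ (↭-trans (↭.++-comm Γ Δ) p₁)) s₁
         (≋.↭-trans (single-≋ (↭.++-comm Γ Δ′)) (≋.↭-sym (≋ₚ.++⁺ʳ 𝒢 g₁)))
  ... | inj₂ (ℱ′ , f″ , f‴) =
    Γ , Δ , 𝒦 ++ ℱ′ ,
    ≋.↭-trans e′ (≋.↭-trans (≋ₚ.++⁺ˡ 𝒦 (≋.↭-trans f′ (prep-≋ f‴)))
      (≋.↭-trans (≋ₚ.↭-shift 𝒦 _) (prep-≋ (≋ₚ.↭-shift 𝒦 ℱ′)))) ,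
    step r (≋.↭-trans (prep-≋ f″) swap-≋) s
      (≋.↭-sym (≋ₚ.↭-shift 𝒦 ℱ′))

  -- Servers

  discard-typed : ∀ {Q} Γ Δ → AllWhyNot Γ → Unique (dom (Γ ++ Δ)) → ⊢ Q ⦂ [ Δ ] →
                  ⊢ discard (dom Γ) Q ⦂ [ Γ ++ Δ ]
  discard-typed []            Δ []              u       d = d
  discard-typed ((z , _) ∷ Γ) Δ ((_ , refl) ∷ a) (z∉ ∷ u) d =
    W (All.All¬⇒¬Any z∉) (discard-typed Γ Δ a u d)

  -- `Δ` is general because it grows: below the contraction of `z` it also holds `σ₁ z` and `σ₂ z`.
  -- The `AllPairs` condition keeps these apart from the names still to be contracted.
  duplicate-typed : ∀ {Q} σ₁ σ₂ Γ Δ → AllWhyNot Γ → Unique (dom Γ) → Disjoint (dom Γ) (dom Δ) →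
    AllPairs (λ z z′ → σ₁ z ≢ z′ × σ₂ z ≢ z′) (dom Γ) →
    ⊢ Q ⦂ [ renameᵉ σ₁ Γ ++ renameᵉ σ₂ Γ ++ Δ ] →
    ⊢ duplicate σ₁ σ₂ (dom Γ) Q ⦂ [ Γ ++ Δ ]
  duplicate-typed σ₁ σ₂ [] Δ a u Γ#Δ c d = d
  duplicate-typed σ₁ σ₂ ((z , _) ∷ Γ) Δ ((B , refl) ∷ a) (z∉ ∷ u) Γ#Δ (c₀ ∷ c) d =
    C z∉′ (exch (single-≋ (pull Γ Δ)) (duplicate-typed σ₁ σ₂ Γ _ a u Γ#Δ′ c
      (exch (single-≋ push) d)))
    where
    pull : ∀ {e f : Name × Type} Γ Δ → Γ ++ e ∷ f ∷ Δ ↭ e ∷ f ∷ Γ ++ Δ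
    pull {e} {f} Γ Δ = ↭-trans (↭.shift e Γ (f ∷ Δ)) (prep e (↭.shift f Γ Δ))
    push : renameᵉ σ₁ ((z , ⁇ B) ∷ Γ) ++ renameᵉ σ₂ ((z , ⁇ B) ∷ Γ) ++ Δ ↭
           renameᵉ σ₁ Γ ++ renameᵉ σ₂ Γ ++ (σ₁ z , ⁇ B) ∷ (σ₂ z , ⁇ B) ∷ Δ
    push = ↭-trans (prep _ (↭.shift _ (renameᵉ σ₁ Γ) _))
             (↭-trans (↭-sym (pull (renameᵉ σ₁ Γ) _))
               (↭.++⁺ˡ (renameᵉ σ₁ Γ) (↭-sym (pull (renameᵉ σ₂ Γ) Δ))))
    z∉′ : z ∉ dom (Γ ++ Δ)
    z∉′ p with dom-++⁻ Γ p
    ... | inj₁ q = All.All¬⇒¬Any z∉ q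
    ... | inj₂ q = Γ#Δ (here refl , q)
    Γ#Δ′ : Disjoint (dom Γ) (σ₁ z ∷ σ₂ z ∷ dom Δ)
    Γ#Δ′ (p , here e)          = proj₁ (All.lookup c₀ p) (sym e)
    Γ#Δ′ (p , there (here e))  = proj₂ (All.lookup c₀ p) (sym e)
    Γ#Δ′ (p , there (there q)) = Γ#Δ (there p , q)

  -- Both `zs` and `dom Γ` enumerate the free names of `P` other than `y` without repetition, so
  -- equality as sets gives a permutation, which lifts from names to the environment.
  reorder : ∀ {P y A Γ zs} → ⊢ P ⦂ [ (y , A) ∷ Γ ] → Unique zs → zs ∼[ set ] (fn P ∖ y) →
            ∃ λ Γ′ → zs ≡ dom Γ′ × Γ ↭ Γ′
  reorder {P} {y} {A} {Γ} {zs} d u zs∼ =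
    ↭.↭-map-inv proj₁ (∼bag⇒↭ (unique∧set⇒bag unique-Γ u (mk⇔ (from zs∼ ∘ Γ⊆) (⊆Γ ∘ to zs∼))))
    where
    unique-Γ : Unique (dom Γ)
    unique-Γ = tail-unique (subst Unique (cong dom (++-identityʳ ((y , A) ∷ Γ))) (typed-unique d))
    Γ⊆ : ∀ {z} → z ∈ dom Γ → z ∈ fn P ∖ y
    Γ⊆ p = ∖⁺ (names⊆fn d (here (there p))) (head-fresh d (here p))
    ⊆Γ : ∀ {z} → z ∈ fn P ∖ y → z ∈ dom Γ
    ⊆Γ p with ∖⁻ {xs = fn P} p
    ... | q , z≢y with fn⊆names d q
    ... | here (here e)  = contradiction e z≢y
    ... | here (there r) = r

  !disp-typed : ∀ {P x y A Γ zs} → AllWhyNot Γ → x ∉ dom Γ → ⊢ P ⦂ [ (y , A) ∷ Γ ] →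
                Unique zs → zs ∼[ set ] (fn P ∖ y) → ⊢ discard zs (x ⟦⟧· 𝟎) ⦂ [ (x , 𝟏) ∷ Γ ]
  !disp-typed {x = x} {Γ = Γ} ⁇Γ x∉ d u zs∼ with reorder d u zs∼
  ... | Γ′ , refl , Γ↭Γ′ =
    exch (single-≋ (↭-trans (↭.++-comm Γ′ _) (prep _ (↭-sym Γ↭Γ′))))
      (discard-typed Γ′ _ (↭.All-resp-↭ Γ↭Γ′ ⁇Γ)
        (subst Unique (sym (map-++ proj₁ Γ′ _)) (Unique.++⁺ u ([] ∷ []) Γ′#x)) (1-I mix₀))
    where
    Γ′#x : Disjoint (dom Γ′) [ x ]
    Γ′#x (p , here refl) = x∉ (↭.∈-resp-↭ (↭.map⁺ proj₁ (↭-sym Γ↭Γ′)) p)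

  -- Injectivity types the two copies. Disjointness of their free names becomes, by `names⊆fn`,
  -- disjointness of the two renamed contexts, as `mix` requires, while the conditions on `x₁` and
  -- `x₂` keep the new subjects outside both contexts.
  !dup-typed : ∀ {P x x₁ x₂ A Γ σ₁ σ₂ zs} → AllWhyNot Γ → ⊢ P ⦂ [ (x , A) ∷ Γ ] →
    Unique zs → zs ∼[ set ] (fn P ∖ x) → Disjoint (fn (sub σ₁ P)) (fn (sub σ₂ P)) →
    InjectiveOn (fn P) σ₁ → InjectiveOn (fn P) σ₂ → x₁ ≢ x₂ → x₁ ∉ zs →
    Disjoint (x₁ ∷ x₂ ∷ []) (map σ₁ zs ++ map σ₂ zs) →
    AllPairs (λ z z′ → σ₁ z ≢ z′ × σ₂ z ≢ z′) zs →
    ⊢ duplicate σ₁ σ₂ zs (x₁ ⟦ x₂ ⟧· (x₁ !⦅ σ₁ x ⦆· sub σ₁ P ∥ x₂ !⦅ σ₂ x ⦆· sub σ₂ P)) ⦂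
      [ (x₁ , ! A ⊗ ! A) ∷ Γ ]
  !dup-typed {P} {x} {x₁} {x₂} {A} {Γ} {σ₁} {σ₂} ⁇Γ d u zs∼ P₁#P₂ inj₁′ inj₂′ x₁≢x₂ x₁∉ xs#zs c
    with reorder d u zs∼
  ... | Γ′ , refl , Γ↭Γ′ =
    exch (single-≋ (↭-trans (↭.++-comm Γ′ _) (prep _ (↭-sym Γ↭Γ′))))
      (duplicate-typed σ₁ σ₂ Γ′ _ ⁇Γ′ u (λ { (p , here refl) → x₁∉ p }) c
        -- `⊗-I` expects the bound name, here `x₂`, in the first environment; hence the exchange
        -- below it.
        (exch (single-≋ rotate) (⊗-I (exch swap-≋ (mix disj
          (!-I (rename-AllWhyNot σ₁ ⁇Γ′) x₁∉₁ d₁) (!-I (rename-AllWhyNot σ₂ ⁇Γ′) x₂∉₂ d₂))))))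
    where
    ⁇Γ′ = ↭.All-resp-↭ Γ↭Γ′ ⁇Γ
    d′ : ⊢ P ⦂ [ (x , A) ∷ Γ′ ]
    d′ = exch (single-≋ (prep _ Γ↭Γ′)) d
    d₁ = sub-typed σ₁ inj₁′ d′
    d₂ = sub-typed σ₂ inj₂′ d′
    rotate : (x₁ , ! A ⊗ ! A) ∷ renameᵉ σ₂ Γ′ ++ renameᵉ σ₁ Γ′ ↭
             renameᵉ σ₁ Γ′ ++ renameᵉ σ₂ Γ′ ++ [ (x₁ , ! A ⊗ ! A) ]
    rotate = ↭-trans (↭.++-comm (_ ∷ renameᵉ σ₂ Γ′) (renameᵉ σ₁ Γ′))
                     (↭.++⁺ˡ (renameᵉ σ₁ Γ′) (↭.++-comm [ _ ] (renameᵉ σ₂ Γ′)))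
    image : ∀ {z} σ → z ∈ dom (renameᵉ σ Γ′) → z ∈ map σ (dom Γ′)
    image σ p = let w , w∈ , e = ∈-dom-rename⁻ σ Γ′ p in subst (_∈ _) (sym e) (∈-map⁺ σ w∈)
    x₁∉₁ : x₁ ∉ dom (renameᵉ σ₁ Γ′)
    x₁∉₁ p = xs#zs (here refl , ∈-++⁺ˡ (image σ₁ p))
    x₁∉₂ : x₁ ∉ dom (renameᵉ σ₂ Γ′)
    x₁∉₂ p = xs#zs (here refl , ∈-++⁺ʳ (map σ₁ (dom Γ′)) (image σ₂ p))
    x₂∉₁ : x₂ ∉ dom (renameᵉ σ₁ Γ′)
    x₂∉₁ p = xs#zs (there (here refl) , ∈-++⁺ˡ (image σ₁ p))
    x₂∉₂ : x₂ ∉ dom (renameᵉ σ₂ Γ′)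
    x₂∉₂ p = xs#zs (there (here refl) , ∈-++⁺ʳ (map σ₁ (dom Γ′)) (image σ₂ p))
    disj : Disjoint (names [ (x₁ , ! A) ∷ renameᵉ σ₁ Γ′ ]) (names [ (x₂ , ! A) ∷ renameᵉ σ₂ Γ′ ])
    disj (p , q)
      with ∈names⇒∈ʰ [ (x₁ , ! A) ∷ renameᵉ σ₁ Γ′ ] p | ∈names⇒∈ʰ [ (x₂ , ! A) ∷ renameᵉ σ₂ Γ′ ] q
    ... | here (here refl) | here (here e)     = x₁≢x₂ e
    ... | here (here refl) | here (there q′)   = x₁∉₂ q′
    ... | here (there p′)  | here (here refl)  = x₂∉₁ p′
    ... | here (there p′)  | here (there q′)   =
      P₁#P₂ (names⊆fn d₁ (here (there p′)) , names⊆fn d₂ (here (there q′)))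

  -- Action and forwarder labels

  data Single : Label → Set where
    act : ∀ {l} → Single (act l)
    fwd : ∀ {x y} → Single (x ↔ y)

  prefix-step : ∀ {l T θ Γ} → Rule l T [ θ ] → Step (act l) [ (subject l , T) ∷ Γ ] [ θ ++ Γ ]
  prefix-step {Γ = Γ} r =
    step (act r) (single-≋ (prep _ (↭-reflexive (sym (++-identityʳ Γ))))) (Γ ∷ []) ≋.↭-refl

  infix 4 _⊢→_

  _⊢→_ : HEnv × Label → Proc → Set
  (𝒢 , l) ⊢→ P′ = ∃ λ 𝒢′ → ⊢ P′ ⦂ 𝒢′ × Step l 𝒢 𝒢′

  frame-disjoint : ∀ {l Q 𝒢 𝒢′ ℋ} → Disjoint (bnˡ l) (fn Q) → ⊢ Q ⦂ ℋ → Step l 𝒢 𝒢′ →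
                   Disjoint (names 𝒢) (names ℋ) → Disjoint (names 𝒢′) (names ℋ)
  frame-disjoint {𝒢′ = 𝒢′} {ℋ} l#Q d s 𝒢#ℋ (p , q) with step-names s (∈names⇒∈ʰ 𝒢′ p)
  ... | inj₁ p′ = 𝒢#ℋ (∈ʰ⇒∈names p′ , q)
  ... | inj₂ p′ = l#Q (p′ , names⊆fn d (∈names⇒∈ʰ ℋ q))

  -- The recursion is lexicographic, on the transition and then on the derivation: `alpha` supplies
  -- a new derivation of unknown size, while `exch` keeps the transition.
  act-typed : ∀ {P l P′ 𝒢} → P —[ l ]→ P′ → Single l → ⊢ P ⦂ 𝒢 → (𝒢 , l) ⊢→ P′
  act-typed t s (exch e d) =
    let 𝒢′ , d′ , st = act-typed t s d in 𝒢′ , d′ , step-resp-≋ e ≋.↭-refl st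
  act-typed out s (⊗-I {Γ = Γ} {Δ} d) = _ , d ,
    step (act r-⊗) (single-≋ (prep _ (↭.++⁺ˡ Γ (↭-reflexive (sym (++-identityʳ Δ))))))
      (Γ ∷ Δ ∷ []) ≋.↭-refl
  act-typed inp s (⅋-I d) = _ , d , prefix-step r-⅋
  act-typed close s (1-I d) = _ , d , step (act r-1) ≋.↭-refl [] ≋.↭-refl
  act-typed wait s (⊥-I _ d) = _ , d , prefix-step r-⊥
  act-typed inl s (⊕-I₁ d) = _ , d , prefix-step r-⊕₁
  act-typed inr s (⊕-I₂ d) = _ , d , prefix-step r-⊕₂
  act-typed outᵗ s (∃-I d) = _ , d , prefix-step r-∃
  act-typed use s (?-I _ d) = _ , d , prefix-step r-?
  act-typed serve s (!-I _ _ d) = _ , d , prefix-step r-!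
  act-typed case₁ s (&-I d _) = _ , d , prefix-step r-&₁
  act-typed case₂ s (&-I _ d) = _ , d , prefix-step r-&₂
  act-typed (inpᵗ A) s (∀-I {Γ = Γ} d) =
    _ , cast (cong (λ Δ → [ _ ∷ Δ ]) (subᵉ-single-weaken A Γ)) (subᵖ-typed (single A) d) ,
    prefix-step r-∀
  act-typed disp s (W x∉ d) = _ , ⊥-I x∉ d , prefix-step r-?W
  act-typed dup s (C x∉ d) = _ , ⅋-I (swap-heads d) , prefix-step r-?C
  act-typed (!disp zs u zs∼) s (!-I ⁇Γ x∉ d) = _ , !disp-typed ⁇Γ x∉ d u zs∼ , prefix-step r-!W
  act-typed (!dup σ₁ σ₂ zs u zs∼ P₁#P₂ i₁ i₂ x₁≢x₂ x₁∉ xs#zs c) s (!-I ⁇Γ _ d) =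
    _ , !dup-typed ⁇Γ d u zs∼ P₁#P₂ i₁ i₂ x₁≢x₂ x₁∉ xs#zs c , prefix-step r-!C
  act-typed fwd₁ s (ax _) = _ , mix₀ , step fwd ≋.↭-refl [] ≋.↭-refl
  act-typed fwd₂ s (ax {x} {y} {A} _) = _ , mix₀ ,
    -- The axiom is read from its other end, where `y` must carry the dual of `A ^⊥`; this is `A`
    -- only up to involution.
    step (fwd {A = A ^⊥})
      (single-≋ (subst (λ B → (x , A ^⊥) ∷ (y , A) ∷ [] ↭ (y , B) ∷ (x , A ^⊥) ∷ [])
                       (sym (^⊥-involutive A)) (_↭_.swap _ _ ↭-refl)))
      [] ≋.↭-refl
  act-typed (alpha e t) s d = act-typed t s (proj₁ (α-typed e) d)
  act-typed (par₁ l#Q t) s (mix {ℋ = ℋ} 𝒢#ℋ d e) =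
    let 𝒢′ , d′ , st = act-typed t s d
    in 𝒢′ ++ ℋ , mix (frame-disjoint l#Q e st 𝒢#ℋ) d′ e , step-++ ℋ st
  act-typed (par₂ l#P t) s (mix {𝒢 = 𝒢} {ℋ} 𝒢#ℋ d e) =
    let ℋ′ , e′ , st = act-typed t s e
        ℋ′#𝒢 = frame-disjoint l#P d st (λ (p , q) → 𝒢#ℋ (q , p))
    in 𝒢 ++ ℋ′ , mix (λ (p , q) → ℋ′#𝒢 (q , p)) d e′ ,
       step-resp-≋ (≋ₚ.++-comm ℋ 𝒢) (≋ₚ.++-comm ℋ′ 𝒢) (step-++ 𝒢 st)
  act-typed (res x∉ y∉ t) s (cut d) =
    let 𝒢′ , d′ , st = act-typed t s d
        Γ′ , Δ′ , 𝒢₀ , e , st′ = step-cut (x∉ ∘ ∈-++⁺ˡ) (y∉ ∘ ∈-++⁺ˡ) st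
    in _ , cut (exch e d′) , st′

  -- Read off from the typings before and after, instead of by induction on the transition.
  act-fn : ∀ {P l P′ 𝒢 z} → P —[ l ]→ P′ → Single l → ⊢ P ⦂ 𝒢 → z ∈ fn P′ → z ∈ fn P ⊎ z ∈ bnˡ l
  act-fn t s d p with act-typed t s d
  ... | 𝒢′ , d′ , st with step-names st (fn⊆names d′ p)
  ... | inj₁ q = inj₁ (names⊆fn d q)
  ... | inj₂ q = inj₂ q

  -- Communication

  infix 3 _—[_⨾_]→_

  _—[_⨾_]→_ : Proc → Act → Act → Proc → Set
  P —[ l ⨾ l′ ]→ P′ = ∃ λ P″ → P —[ act l ]→ P″ × P″ —[ act l′ ]→ P′

  -- Both orders are proved together because `pair-comm` exchanges them. In `syn` the later label
  -- must avoid the free names of the residual of the other component: by `act-fn` these are old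
  -- free names or bound names of the earlier label, and both are excluded by the premises of `syn`.
  interleave : ∀ {P l l′ P′ 𝒢} → P —[ l ∥ l′ ]→ P′ → ⊢ P ⦂ 𝒢 → P —[ l ⨾ l′ ]→ P′ × P —[ l′ ⨾ l ]→ P′
  interleave t (exch e d) = interleave t d
  interleave (syn {Q = Q} l#l′ l#Q l′#P t t′) (mix _ d e) =
    (_ , par₁ l#Q t , par₂ (λ (p , q) → [ (λ r → l′#P (p , r)) , (λ r → l#l′ (r , p)) ]′
                                         (act-fn t act d q)) t′) ,
    (_ , par₂ l′#P t′ , par₁ (λ (p , q) → [ (λ r → l#Q (p , r)) , (λ r → l#l′ (p , r)) ]′
                                           (act-fn t′ act e q)) t)
  interleave (pair-comm t) d = let r , r′ = interleave t d in r′ , r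
  interleave (alpha e t) d =
    let (_ , t₁ , t₂) , (_ , t₃ , t₄) = interleave t (proj₁ (α-typed e) d)
    in (_ , alpha e t₁ , t₂) , (_ , alpha e t₃ , t₄)
  interleave {_ ∥ Q} {l} {l′} (par₁ #Q t) (mix _ d e) =
    let (_ , t₁ , t₂) , (_ , t₃ , t₄) = interleave t d
        #Q₁ : Disjoint (bnᵃ l) (fn Q)
        #Q₁ (p , q) = #Q (∈-++⁺ˡ p , q)
        #Q₂ : Disjoint (bnᵃ l′) (fn Q)
        #Q₂ (p , q) = #Q (∈-++⁺ʳ (bnᵃ l) p , q)
    in (_ , par₁ #Q₁ t₁ , par₁ #Q₂ t₂) , (_ , par₁ #Q₂ t₃ , par₁ #Q₁ t₄)
  interleave {P ∥ _} {l} {l′} (par₂ #P t) (mix _ d e) =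
    let (_ , t₁ , t₂) , (_ , t₃ , t₄) = interleave t e
        #P₁ : Disjoint (bnᵃ l) (fn P)
        #P₁ (p , q) = #P (∈-++⁺ˡ p , q)
        #P₂ : Disjoint (bnᵃ l′) (fn P)
        #P₂ (p , q) = #P (∈-++⁺ʳ (bnᵃ l) p , q)
    in (_ , par₂ #P₁ t₁ , par₂ #P₂ t₂) , (_ , par₂ #P₂ t₃ , par₂ #P₁ t₄)
  interleave {l = l} {l′} (res x∉ y∉ t) (cut d) =
    let (_ , t₁ , t₂) , (_ , t₃ , t₄) = interleave t d
    in (_ , res (x∉ ∘ left) (y∉ ∘ left) t₁ , res (x∉ ∘ right) (y∉ ∘ right) t₂) ,
       (_ , res (x∉ ∘ right) (y∉ ∘ right) t₃ , res (x∉ ∘ left) (y∉ ∘ left) t₄)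
    where
    left : ∀ {z} → z ∈ cn (act l) → z ∈ cn (l ∥ l′)
    left (here p)  = here p
    left (there p) = there (there (∈-++⁺ˡ p))
    right : ∀ {z} → z ∈ cn (act l′) → z ∈ cn (l ∥ l′)
    right (here p)  = there (here p)
    right (there p) = there (there (∈-++⁺ʳ (bnᵃ l) p))

  -- Since names are distinct, `x` determines its environment and its type there. This identifies
  -- the environment that a step consumes with the one that the cut names.
  locate : ∀ {P x T T′ Γ 𝒢 Ξ ℋ} → ⊢ P ⦂ ((x , T) ∷ Γ) ∷ 𝒢 →
           ((x , T) ∷ Γ) ∷ 𝒢 ≋ ((x , T′) ∷ Ξ) ∷ ℋ → T ≡ T′ × Γ ↭ Ξ × 𝒢 ≋ ℋ
  locate d e with cons-cons e
  ... | inj₂ (ℱ , f , _) =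
    contradiction refl (head-fresh d (there (∈ʰ-resp-≋ (≋.↭-sym f) (here (here refl)))))
  ... | inj₁ (p , f) with ↭.∈-resp-↭ p (here refl)
  ... | here refl = refl , ↭.drop-∷ p , f
  ... | there q   = contradiction refl (head-fresh (exch e d) (here (∈-map⁺ proj₁ q)))

  -- The pieces `𝒦` and `𝒦′` left by the two partners are still separate, so each communication rule
  -- can choose which names to cut.
  data Comm (l l′ : Act) (A : Type) (Γ Δ : Env) (𝒢 : HEnv) (P′ : Proc) : Set where
    comm : ∀ {Θ Θ′ Γ′ Δ′ 𝒦 𝒦′} → Rule l A Θ → Rule l′ (A ^⊥) Θ′ →
           Γ′ ++ Δ′ ↭ Γ ++ Δ → Distribute Θ Γ′ 𝒦 → Distribute Θ′ Δ′ 𝒦′ →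
           ⊢ P′ ⦂ 𝒦 ++ 𝒦′ ++ 𝒢 → Comm l l′ A Γ Δ 𝒢 P′

  communicate : ∀ {P P′ l l′ A Γ Δ 𝒢} → P —[ l ∥ l′ ]→ P′ →
    ⊢ P ⦂ ((subject l , A) ∷ Γ) ∷ ((subject l′ , A ^⊥) ∷ Δ) ∷ 𝒢 → Comm l l′ A Γ Δ 𝒢 P′
  communicate {𝒢 = 𝒢} t d with interleave t d
  ... | (P″ , t₁ , t₂) , _ with act-typed t₁ act d
  ... | 𝒢₁ , d₁ , step {𝒦 = 𝒦} (act r) e s e′ with locate d e
  ... | refl , p , f
    -- The first label leaves the environment of the second subject untouched; it is moved to the
    -- front so that `locate` applies again.
    with exch (≋.↭-trans e′ (≋.↭-trans (≋ₚ.++⁺ˡ 𝒦 (≋.↭-sym f)) (≋ₚ.↭-shift 𝒦 𝒢))) d₁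
  ... | d₁′ with act-typed t₂ act d₁′
  ... | 𝒢₂ , d₂ , step {𝒦 = 𝒦′} (act r′) g s′ g′ with locate d₁′ g
  ... | refl , q , f′ = comm r r′ (↭-sym (↭.++⁺ p q)) s s′
    (exch (≋.↭-trans g′ (≋.↭-trans (≋ₚ.++⁺ˡ 𝒦′ (≋.↭-sym f′)) (≋ₚ.shifts 𝒦′ 𝒦))) d₂)

  -- Covers every communication in which each partner leaves one environment with one new name:
  -- choices, types, and the three server interactions.
  cut₁-typed : ∀ {P u v A Γ Δ Ξ 𝒢 𝒦 𝒦′} → Γ ++ Δ ↭ Ξ →
    Distribute [ [ (u , A) ] ] Γ 𝒦 → Distribute [ [ (v , A ^⊥) ] ] Δ 𝒦′ →
    ⊢ P ⦂ 𝒦 ++ 𝒦′ ++ 𝒢 → ⊢ ⦅ν u ∣ v ⦆ P ⦂ Ξ ∷ 𝒢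
  cut₁-typed r (Γ₁ ∷ []) (Δ₁ ∷ []) d =
    exch (single-≋ (subst₂ (λ Γ Δ → Γ ++ Δ ↭ _) (++-identityʳ Γ₁) (++-identityʳ Δ₁) r)) (cut d)

  -- The forwarder consumes an environment consisting of `z` and `y` only, so `Δ` is just `z`, at
  -- type `A` up to involution. Replacing `x` by `z` in what remains thus gives the conclusion of
  -- the cut.
  com-↔-typed : ∀ {P P′ x y z A Γ Δ 𝒢} → P —[ z ↔ y ]→ P′ →
    ⊢ P ⦂ ((x , A) ∷ Γ) ∷ ((y , A ^⊥) ∷ Δ) ∷ 𝒢 → ⊢ P′ [ z / x ] ⦂ (Γ ++ Δ) ∷ 𝒢
  com-↔-typed {P} {P′} {x} {y} {z} {A} {Γ} {Δ} {𝒢} t d with act-typed t fwd d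
  ... | 𝒢₁ , d₁ , step {ℋ = ℋ} fwd e [] e′
    with locate (exch swap-≋ d)
           (≋.↭-trans swap-≋
             (≋.↭-trans e (single-≋ (_↭_.swap _ _ ↭-refl))))
  ... | refl , p , f = exch (single-≋ Γ∷z) (cast eq (sub-typed _ inj d₁′))
    where
    d₁′ : ⊢ P′ ⦂ ((x , A) ∷ Γ) ∷ 𝒢
    d₁′ = exch (≋.↭-trans e′ (≋.↭-sym f)) d₁
    -- `z` has gone with the consumed environment and, names being distinct, occurs in no other; so
    -- sending `x` to `z` is injective on the free names of `P′`.
    z∉P′ : z ∉ fn P′
    z∉P′ q = head-fresh (exch e d) (there (∈ʰ-resp-≋ e′ (fn⊆names d₁ q))) refl
    inj : InjectiveOn (fn P′) ((λ w → w) [ x ↦ z ])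
    inj = update-injective (fn P′) (λ _ _ e → e) λ q →
      let w , w∈ , z≡w = ∈-map⁻ (λ w → w) q
      in z∉P′ (subst (_∈ fn P′) (sym z≡w) (proj₁ (∖⁻ {xs = fn P′} w∈)))
    eq : renameʰ ((λ w → w) [ x ↦ z ]) (((x , A) ∷ Γ) ∷ 𝒢) ≡ ((z , A) ∷ Γ) ∷ 𝒢
    eq = trans (rename-update (λ w → w) z d₁′)
           (cong₂ (λ Δ ℋ → ((z , A) ∷ Δ) ∷ ℋ) (renameᵉ-id Γ) (renameʰ-id 𝒢))
    Γ∷z : (z , A) ∷ Γ ↭ Γ ++ Δ
    Γ∷z = ↭-trans (↭.++-comm [ (z , A) ] Γ)
            (↭.++⁺ˡ Γ (↭-sym (subst (λ B → Δ ↭ [ (z , B) ]) (^⊥-involutive A) p)))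

  -- Keeping `𝒢` fixed is what allows an enclosing `cut` or `mix` to be reapplied unchanged.
  τ-typed : ∀ {P P′ 𝒢} → P —[ τ ]→ P′ → ⊢ P ⦂ 𝒢 → ⊢ P′ ⦂ 𝒢
  τ-typed t (exch e d) = exch e (τ-typed t d)
  τ-typed (alpha e t) d = τ-typed t (proj₁ (α-typed e) d)
  τ-typed (par₁ _ t) (mix 𝒢#ℋ d e) = mix 𝒢#ℋ (τ-typed t d) e
  τ-typed (par₂ _ t) (mix 𝒢#ℋ d e) = mix 𝒢#ℋ d (τ-typed t e)
  τ-typed (res _ _ t) (cut d) = cut (τ-typed t d)
  τ-typed (com-1 t) (cut d) with communicate t d
  -- The closing side has no rest to distribute, so the environment of the waiting side is already
  -- the whole merged one and no cut remains.
  ... | comm r-1 r-⊥ p [] (Δ₁ ∷ []) d′ =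
    exch (single-≋ (↭-trans (↭-reflexive (sym (++-identityʳ Δ₁))) p)) d′
  τ-typed (com-⊗ t) (cut {𝒢 = 𝒢} d) with communicate t d
  ... | comm r-⊗ r-⅋ p (Γ₁ ∷ Γ₂ ∷ []) (Δ₁ ∷ []) d′ =
    -- The inner cut on `x′` and `y′` merges `Γ₁` with the environment of `y`; `x` stays apart with
    -- `Γ₂`, so the outer cut on `x` and `y` still joins distinct environments.
    exch (single-≋ (↭-trans q p))
      (cut (exch (≋.↭-trans swap-≋
                   (prep-≋ (single-≋ (↭.shift _ Γ₁ Δ₁))))
        (cut (exch (prep-≋ swap-≋) d′))))
    where
    q : Γ₂ ++ Γ₁ ++ Δ₁ ↭ (Γ₁ ++ Γ₂ ++ []) ++ (Δ₁ ++ [])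
    q = ↭-trans (↭.shifts Γ₂ Γ₁)
          (↭-reflexive (trans (sym (++-assoc Γ₁ Γ₂ Δ₁))
            (cong₂ (λ Θ Ξ → (Γ₁ ++ Θ) ++ Ξ) (sym (++-identityʳ Γ₂)) (sym (++-identityʳ Δ₁)))))
  τ-typed (com-⊕₁ t) (cut d) with communicate t d
  ... | comm r-⊕₁ r-&₁ p s s′ d′ = cut₁-typed p s s′ d′
  τ-typed (com-⊕₂ t) (cut d) with communicate t d
  ... | comm r-⊕₂ r-&₂ p s s′ d′ = cut₁-typed p s s′ d′
  τ-typed (com-∃ {A = A} t) (cut {y = y} d) with communicate t d
  ... | comm (r-∃ {B = B}) r-∀ p s s′ d′ =
    -- The receiver instantiates the dual of `B`, whereas the cut asks for the dual of the instance.
    cut₁-typed p s (subst (λ T → Distribute [ [ (y , T) ] ] _ _) (subᵗ-^⊥ (single A) B) s′) d′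
  τ-typed (com-W t) (cut d) with communicate t d
  ... | comm r-?W r-!W p s s′ d′ = cut₁-typed p s s′ d′
  τ-typed (com-? t) (cut d) with communicate t d
  ... | comm r-? r-! p s s′ d′ = cut₁-typed p s s′ d′
  τ-typed (com-C t) (cut d) with communicate t d
  ... | comm r-?C r-!C p s s′ d′ = cut₁-typed p s s′ d′
  τ-typed (com-↔ _ _ t) (cut d) = com-↔-typed t d

  typability-preservation : (P : Proc) → WellTyped P → (l : Label) (P′ : Proc) →
                            P —[ l ]→ P′ → WellTyped P′
  typability-preservation P (𝒢 , d) τ        P′ t = 𝒢 , τ-typed t d
  typability-preservation P (𝒢 , d) (x ↔ y)  P′ t = map₂ proj₁ (act-typed t fwd d)
  typability-preservation P (𝒢 , d) (act l)  P′ t = map₂ proj₁ (act-typed t act d)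
  typability-preservation P (𝒢 , d) (l ∥ l′) P′ t with proj₁ (interleave t d)
  ... | _ , t₁ , t₂ = map₂ proj₁ (act-typed t₂ act (proj₁ (proj₂ (act-typed t₁ act d))))

corollary4p12 : (𝒩 : Names) → let open πLL 𝒩 in
    (P : Proc) → WellTyped P → (l : Label) (P′ : Proc) → P —[ l ]→ P′ → WellTyped P′
corollary4p12 = typability-preservation
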